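{- 1. Up to isomorphism, the $(-1)$-critical trees with $n$ vertices are exactly the trees $P_{4,\frac{n-4}{2}}$ where $n$ is an even integer $\ge 6$. (That is, a tree $T$ with $n$ vertices is $(-1)$-critical if and only if $n$ is even, $n\geq 6$ and $T\simeq P_{4,\frac{n-4}{2}}$.) 2. Up to isomorphism, the $(-\lfloor\frac{n}{2}\rfloor)$-critical trees with $n$ vertices are exactly the trees $A_n$ where $n$ is an odd integer $\ge 5$. (That is, a tree $T$ with $n$ vertices is $(-\lfloor\frac{n}{2}\rfloor)$-critical if and only if $n$ is odd, $n\ge 5$ and $T\simeq A_n$.)
   Context: Graphs are finite, simple and undirected. For a graph $G=(V,E)$, a module of $G$ is a subset $M\subseteq V$ such that every vertex outside $M$ is adjacent to all or to none of the vertices of $M$. The modules $\emptyset$, $\{x\}$ ($x\in V$) and $V$ are trivial. $G$ is decomposable if it has a nontrivial module; $G$ is prime if it has at least four vertices and all its modules are trivial. A vertex $x$ of a prime graph $G$ is critical if $G-x$ (the subgraph induced on $V\setminus\{x\}$) is decomposable, and non-critical otherwise. A prime graph with exactly $k$ non-critical vertices is called $(-k)$-critical. For integers $k\ge 4$, $t\ge 1$, $P_{k,t}$ is the tree with vertex set $\{1,\dots,2t+k\}$ and edges: $\{2t+i,2t+i+1\}$ for $1\le i\le k-1$ (a path on $2t+1,\dots,2t+k$); $\{2i-1,2i\}$ for $1\le i\le t$; and $\{2t+2,2i\}$ for $1\le i\le t$. For integers $m\ge 2$, $A_{2m+1}$ is the tree with vertex set $\{0,\dots,2m\}$ and edges $\{0,i\}$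 and $\{i,i+m\}$ for $1\le i\le m$. -}

module Defs where

open import Data.Fin using (Fin; zero; suc; toℕ; fromℕ; inject₁; punchIn)
open import Data.Fin.Subset using (Subset; _∈_; _∉_; ⊥; ⊤; ⁅_⁆; ∣_∣)
open import Data.Nat using (ℕ; zero; suc; pred; _+_; _*_; _∸_; _≤_; z≤n; s≤s; s≤s⁻¹; _≟_; _≤?_)
open import Data.Nat.Properties
  using (anyUpTo?; +-comm; 1+n≢n; <-irrefl; *-monoʳ-≤; ≤-trans; m<m+n)
open import Data.Product using (∃-syntax; _×_; _,_)
open import Data.Sum using (_⊎_; inj₁; inj₂; [_,_])
open import Function using (_∘_; _⇔_; _↔_; Inverse)
open import Function.Definitions using (Injective)
open import Level using (0ℓ)
open import Relation.Binary using (Rel; Decidable; Symmetric)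
open import Relation.Binary.Construct.Closure.ReflexiveTransitive using (Star)
open import Relation.Binary.Construct.Closure.Symmetric using (SymClosure; fwd; bwd; symmetric)
open import Relation.Binary.PropositionalEquality using (_≡_; refl; sym; trans)
open import Relation.Nullary using (Dec; ¬_)
open import Relation.Nullary.Decidable using (map′; _×-dec_; _⊎-dec_)
open import Relation.Unary using (Pred)
import Relation.Unary as U

record Graph (n : ℕ) : Set₁ where
  field
    Adj        : Rel (Fin n) 0ℓ
    adj?       : Decidable Adj
    adj-sym    : Symmetric Adj
    adj-irrefl : ∀ x → ¬ Adj x x

open Graph public

record _≃_ {m n : ℕ} (G : Graph m) (H : Graph n) : Set where
  field
    bijection : Fin m ↔ Fin n
    preserves : ∀ x y → Adj G x y ⇔ Adj H (Inverse.to bijection x) (Inverse.to bijection y)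

infix 4 _≃_

-- The subgraph induced on all vertices but x: punchIn x enumerates, in
-- increasing order, the elements of Fin (suc n) different from x.
_-_ : ∀ {n} → Graph n → Fin n → Graph (pred n)
_-_ {suc n} G x = record
  { Adj        = λ i j → Adj G (punchIn x i) (punchIn x j)
  ; adj?       = λ i j → adj? G (punchIn x i) (punchIn x j)
  ; adj-sym    = adj-sym G
  ; adj-irrefl = λ i → adj-irrefl G (punchIn x i)
  }

infixl 6 _-_

Connected : ∀ {n} → Graph n → Set
Connected G = ∀ x y → Star (Adj G) x y

-- A cycle of length m + 3, given by its distinct vertices in cyclic order.
record Cycle {n : ℕ} (G : Graph n) (m : ℕ) : Set where
  field
    vertex   : Fin (3 + m) → Fin n
    distinct : Injective _≡_ _≡_ vertex
    step     : ∀ (i : Fin (2 + m)) → Adj G (vertex (inject₁ i)) (vertex (suc i))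
    close    : Adj G (vertex (fromℕ (2 + m))) (vertex zero)

Acyclic : ∀ {n} → Graph n → Set
Acyclic G = ∀ m → ¬ Cycle G m

IsTree : ∀ {n} → Graph n → Set
IsTree G = Connected G × Acyclic G

IsModule : ∀ {n} → Graph n → Subset n → Set
IsModule G M = ∀ x → x ∉ M →
  (∀ y → y ∈ M → Adj G x y) ⊎ (∀ y → y ∈ M → ¬ Adj G x y)

Trivial : ∀ {n} → Subset n → Set
Trivial M = M ≡ ⊥ ⊎ (∃[ x ] M ≡ ⁅ x ⁆) ⊎ M ≡ ⊤

Decomposable : ∀ {n} → Graph n → Set
Decomposable G = ∃[ M ] IsModule G M × ¬ Trivial M

Prime : ∀ {n} → Graph n → Set
Prime {n} G = 4 ≤ n × (∀ M → IsModule G M → Trivial M)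

Critical : ∀ {n} → Graph n → Fin n → Set
Critical G x = Decomposable (G - x)

NonCritical : ∀ {n} → Graph n → Fin n → Set
NonCritical G x = ¬ Critical G x

-- (-k)-critical graphs; S is the set of all non-critical vertices.
MinusCritical : ∀ {n} → ℕ → Graph n → Set
MinusCritical k G =
  Prime G × (∃[ S ] (∀ x → x ∈ S ⇔ NonCritical G x) × ∣ S ∣ ≡ k)

-- E gives each edge, in one arbitrary orientation, in terms of the labels.
fromEdges : ∀ {n} (label : Fin n → ℕ) (E : Rel ℕ 0ℓ) →
            Decidable E → (∀ a → ¬ E a a) → Graph n
fromEdges label E E? loopless = record
  { Adj        = λ x y → SymClosure E (label x) (label y)
  ; adj?       = λ x y → map′ [ fwd , bwd ] (λ { (fwd e) → inj₁ e ; (bwd e) → inj₂ e })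
                           (E? (label x) (label y) ⊎-dec E? (label y) (label x))
  ; adj-sym    = symmetric E
  ; adj-irrefl = λ x → λ { (fwd e) → loopless _ e ; (bwd e) → loopless _ e }
  }

∃[1≤i≤_]_ : ℕ → Pred ℕ 0ℓ → Set
∃[1≤i≤ m ] P = ∃[ i ] (1 ≤ i × i ≤ m) × P i

between? : ∀ {P : Pred ℕ 0ℓ} → U.Decidable P → ∀ m → Dec (∃[1≤i≤ m ] P)
between? P? m =
  map′ (λ { (i , i<1+m , 1≤i , p) → i , (1≤i , s≤s⁻¹ i<1+m) , p })
       (λ { (i , (1≤i , i≤m) , p) → i , s≤s i≤m , 1≤i , p })
       (anyUpTo? (λ i → 1 ≤? i ×-dec P? i) (suc m))

-- The edges of P_{k,t} on the labels 1, …, 2t+k; intended for k ≥ 4, t ≥ 1.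
PEdge : ℕ → ℕ → Rel ℕ 0ℓ
PEdge k t a b =
    (∃[1≤i≤ k ∸ 1 ] λ i → a ≡ 2 * t + i × b ≡ 2 * t + i + 1)
  ⊎ (∃[1≤i≤ t ] λ i → a ≡ 2 * i ∸ 1 × b ≡ 2 * i)
  ⊎ (∃[1≤i≤ t ] λ i → a ≡ 2 * t + 2 × b ≡ 2 * i)

PEdge? : ∀ k t → Decidable (PEdge k t)
PEdge? k t a b =
        between? (λ i → a ≟ 2 * t + i ×-dec b ≟ 2 * t + i + 1) (k ∸ 1)
  ⊎-dec between? (λ i → a ≟ 2 * i ∸ 1 ×-dec b ≟ 2 * i) t
  ⊎-dec between? (λ i → a ≟ 2 * t + 2 ×-dec b ≟ 2 * i) t

PEdge-loopless : ∀ k t a → ¬ PEdge k t a a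
PEdge-loopless k t a (inj₁ (i , _ , p , q)) =
  1+n≢n (trans (+-comm 1 (2 * t + i)) (trans (sym q) p))
PEdge-loopless k t a (inj₂ (inj₁ (suc i , _ , p , q))) = 1+n≢n (trans (sym q) p)
PEdge-loopless k t a (inj₂ (inj₂ (i , (_ , i≤t) , refl , q))) =
  <-irrefl (sym q) (≤-trans (s≤s (*-monoʳ-≤ 2 i≤t)) (m<m+n (2 * t) (s≤s z≤n)))

P : (k t : ℕ) → Graph (2 * t + k)
P k t = fromEdges (suc ∘ toℕ) (PEdge k t) (PEdge? k t) (PEdge-loopless k t)

-- The edges of A_{2m+1} on the labels 0, …, 2m; intended for m ≥ 2.
AEdge : ℕ → Rel ℕ 0ℓ
AEdge m a b =
    (∃[1≤i≤ m ] λ i → a ≡ 0 × b ≡ i)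
  ⊎ (∃[1≤i≤ m ] λ i → a ≡ i × b ≡ i + m)

AEdge? : ∀ m → Decidable (AEdge m)
AEdge? m a b =
        between? (λ i → a ≟ 0 ×-dec b ≟ i) m
  ⊎-dec between? (λ i → a ≟ i ×-dec b ≟ i + m) m

AEdge-loopless : ∀ m a → ¬ AEdge m a a
AEdge-loopless m a (inj₁ (_ , (() , _) , refl , refl))
AEdge-loopless m a (inj₂ (i , (1≤i , i≤m) , refl , q)) =
  <-irrefl q (m<m+n i (≤-trans 1≤i i≤m))

A[2*_+1] : (m : ℕ) → Graph (2 * m + 1)
A[2* m +1] = fromEdges toℕ (AEdge m) (AEdge? m) (AEdge-loopless m)

{-# OPTIONS --safe #-}
module Submission where

-- In a graph without triangles and squares, two elements of a nontrivial module are leaves with the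
-- same support. So a tree on at least four vertices is prime iff no two leaves share a support, and
-- a vertex x of a prime tree is non-critical iff it is a leaf whose deletion does not turn its
-- support y into a second leaf of some vertex.
--
-- Let z, w, v be the end of a long path from a root. Then z is a leaf and w has degree two, and
-- either v supports a leaf, which is then non-critical because v has degree at least three, or z is
-- non-critical. If ℓ is the only non-critical vertex, rooting the tree at the support of ℓ shows
-- that it has depth two. If there are ⌊n/2⌋ non-critical vertices, they and their supports cover all
-- vertices but at most one; rooting the tree there, v supports no leaf, so v is not covered and is
-- the root. In both cases the tree is a spider with legs of length two and at most one of length one.

open import Defs
open import Data.Empty using (⊥)
open import Data.Fin using (Fin; zero; suc; toℕ; fromℕ; fromℕ<; inject₁; punchIn; punchOut)
open import Data.Fin.Properties
  using (_≟_; any?; all?; injective⇒≤; suc-injective; toℕ<n; toℕ-injective; toℕ-fromℕ<;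
         punchInᵢ≢i; punchIn-injective; punchIn-punchOut)
open import Data.Fin.Permutation using (↔⇒≡)
open import Data.Fin.Subset using (Subset; inside; outside; _∈_; _∉_; ⁅_⁆; ∣_∣)
open import Data.Fin.Subset.Properties
  using (_∈?_; nonempty?; Empty-unique; ⊆-antisym; x∈⁅x⁆; x∈⁅y⁆⇒x≡y; ∉⊥; ∈⊤; ∣⁅x⁆∣≡1; ⊆⊤)
open import Data.List using (List; []; _∷_; length; lookup; map)
open import Data.List.Membership.DecPropositional using () renaming (_∈?_ to ∈ₗ?)
open import Data.List.Membership.Propositional using () renaming (_∈_ to _∈ₗ_; _∉_ to _∉ₗ_)
open import Data.List.Membership.Propositional.Properties using (∈-lookup; ∈-map⁻)
open import Data.List.Relation.Unary.Any using (here; there)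
open import Data.Nat as ℕ using (ℕ; zero; suc; _+_; _*_; _∸_; _≤_; _<_; z≤n; s≤s; s≤s⁻¹; ⌊_/2⌋)
open import Data.Nat.Divisibility using (_∣_; _∤_; divides; ∣m∣n⇒∣m+n; ∣m+n∣m⇒∣n; m∣m*n; ∣1⇒≡1)
open import Data.Nat.Properties as ℕ using (≤-refl; ≤-trans; +-suc; +-comm; n≮n; m≤n⇒m≤1+n)
open import Data.Product using (Σ; ∃₂; ∃-syntax; _×_; _,_; proj₁; proj₂)
open import Data.Sum using (_⊎_; inj₁; inj₂; [_,_])
open import Data.Vec using ([]; _∷_; here; there; tabulate)
open import Data.Vec.Properties using (lookup⇒[]=; []=⇒lookup; lookup∘tabulate)
import Data.Vec.Functional as F
open import Function using (_∘_; _⇔_; Inverse; Equivalence; mk⇔; mk↔ₛ′; id)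
open import Function.Definitions using (Injective)
open import Level using (0ℓ)
open import Relation.Binary using (Rel; Decidable)
open import Relation.Binary.Construct.Closure.ReflexiveTransitive
  using (Star; ε; _◅_; _◅◅_; kleisliStar)
open import Relation.Binary.Construct.Closure.Symmetric using (SymClosure; fwd; bwd; symmetric)
open import Relation.Binary.PropositionalEquality
  using (_≡_; _≢_; refl; sym; trans; cong; subst; subst₂; ≢-sym)
open import Relation.Nullary using (Dec; yes; no; ¬_; contradiction)
open import Relation.Nullary.Decidable
  using (_×-dec_; _⊎-dec_; _→-dec_; ¬?; does; ¬¬-excluded-middle; decidable-stable; dec-true)
open import Relation.Unary using (Pred)
import Relation.Unary as U

private variable
  k n e m : ℕ
  G H : Graph n
  a b c r u v w x y z : Fin n
  xs ys : List (Fin n)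

-- Finite sets

-- Reachability in `G - x` comes with no decision procedure. Where a split on it is wanted the goal
-- is a negation, so decidability up to double negation, obtained point by point, is enough.
¬¬-decidable : (P : Pred (Fin n) 0ℓ) → ¬ ¬ U.Decidable P
¬¬-decidable {zero} P ¬P? = ¬P? λ ()
¬¬-decidable {suc n} P ¬P? =
  ¬¬-excluded-middle λ P₀? → ¬¬-decidable (P ∘ suc) λ P₊? →
    ¬P? λ { zero → P₀? ; (suc x) → P₊? x }

module _ {P : Pred (Fin n) 0ℓ} (P? : U.Decidable P) where

  comprehension : Subset n
  comprehension = tabulate (does ∘ P?)

  ∈-comprehension⁺ : P x → x ∈ comprehension
  ∈-comprehension⁺ {x} p =
    lookup⇒[]= x _ (trans (lookup∘tabulate (does ∘ P?) x) (dec-true (P? x) p))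

  ∈-comprehension⁻ : x ∈ comprehension → P x
  ∈-comprehension⁻ {x} x∈ with P? x | trans (sym (lookup∘tabulate (does ∘ P?) x)) ([]=⇒lookup x∈)
  ... | yes p | _ = p

-- Presenting a subset as an injective family turns comparisons of sizes into applications of
-- `injective⇒≤`.
record Enumeration (S : Subset n) : Set where
  field
    elem       : Fin ∣ S ∣ → Fin n
    injective  : Injective _≡_ _≡_ elem
    member     : ∀ i → elem i ∈ S
    exhaustive : ∀ {x} → x ∈ S → ∃[ i ] elem i ≡ x

enumerate : (S : Subset n) → Enumeration S
enumerate [] = record
  { elem = λ () ; injective = λ { {()} } ; member = λ () ; exhaustive = λ () }
enumerate (outside ∷ S) = record
  { elem       = suc ∘ elem
  ; injective  = injective ∘ suc-injective
  ; member     = λ i → there (member i)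
  ; exhaustive = λ { (there x∈S) → let i , eq = exhaustive x∈S in i , cong suc eq }
  } where open Enumeration (enumerate S)
enumerate (inside ∷ S) = record
  { elem       = zero F.∷ (suc ∘ elem)
  ; injective  = λ { {zero} {zero} _ → refl
                   ; {suc i} {suc j} eq → cong suc (injective (suc-injective eq)) }
  ; member     = λ { zero → here ; (suc i) → there (member i) }
  ; exhaustive = λ { here → zero , refl
                   ; (there x∈S) → let i , eq = exhaustive x∈S in suc i , cong suc eq }
  } where open Enumeration (enumerate S)

image-size : (S : Subset n) (f : Fin m → Fin n) → Injective _≡_ _≡_ f →
             (∀ x → x ∈ S ⇔ (∃[ i ] f i ≡ x)) → ∣ S ∣ ≡ m
image-size {m = m} S f f-inj S⇔f = ℕ.≤-antisym
  (injective⇒≤ {f = λ i → proj₁ (preimage i)}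
     (λ {i} {j} eq → injective (trans (sym (proj₂ (preimage i)))
                       (trans (cong f eq) (proj₂ (preimage j))))))
  (injective⇒≤ {f = λ i → proj₁ (index i)}
     (λ {i} {j} eq → f-inj (trans (sym (proj₂ (index i)))
                       (trans (cong elem eq) (proj₂ (index j))))))
  where
  open Enumeration (enumerate S)
  preimage : ∀ i → ∃[ j ] f j ≡ elem i
  preimage i = Equivalence.to (S⇔f _) (member i)
  index : ∀ j → ∃[ i ] elem i ≡ f j
  index j = exhaustive (Equivalence.from (S⇔f _) (j , refl))

singleton : (S : Subset n) → ∣ S ∣ ≡ 1 → ∃[ x ] x ∈ S × (∀ y → y ∈ S → y ≡ x)
singleton S eq = elem zero₁ , member zero₁ ,
  λ y y∈S → let i , eᵢ≡y = exhaustive y∈S in trans (sym eᵢ≡y) (cong elem (unique eq i zero₁))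
  where
  open Enumeration (enumerate S)
  unique : ∀ {k} → k ≡ 1 → (i j : Fin k) → i ≡ j
  unique refl zero zero = refl
  zero₁ : Fin ∣ S ∣
  zero₁ = subst Fin (sym eq) zero

-- If every element were `a` or `b`, telling the two apart would inject `Fin n` into `Fin 2`. The
-- elements `a` and `b` may coincide.
third-element : 3 ≤ n → (a b : Fin n) → ∃[ d ] d ≢ a × d ≢ b
third-element {n} 3≤n a b with any? (λ d → ¬? (d ≟ a) ×-dec ¬? (d ≟ b))
... | yes d = d
... | no ∄d = contradiction (≤-trans 3≤n (injective⇒≤ side-injective)) (n≮n 2)
  where
  only : ∀ d → d ≢ a → d ≡ b
  only d d≢a = decidable-stable (d ≟ b) (λ d≢b → ∄d (d , d≢a , d≢b))
  side : Fin n → Fin 2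
  side d with d ≟ a
  ... | yes _ = zero
  ... | no _  = suc zero
  side-injective : Injective _≡_ _≡_ side
  side-injective {d} {d′} eq with d ≟ a | d′ ≟ a
  ... | yes d≡a | yes d′≡a = trans d≡a (sym d′≡a)
  ... | no d≢a  | no d′≢a  = trans (only d d≢a) (sym (only d′ d′≢a))

-- Leaves

adjacent⇒≢ : (G : Graph n) → Adj G x y → x ≢ y
adjacent⇒≢ G x~y refl = adj-irrefl G _ x~y

-- y is the support of the leaf x.
Leaf : Graph n → Fin n → Fin n → Set
Leaf G x y = Adj G x y × (∀ z → Adj G x z → z ≡ y)

leaf? : (G : Graph n) (x y : Fin n) → Dec (Leaf G x y)
leaf? G x y = adj? G x y ×-dec all? (λ z → adj? G x z →-dec z ≟ y)

NoTwinLeaves : Graph n → Set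
NoTwinLeaves G = ∀ {a b y} → Leaf G a y → Leaf G b y → a ≡ b

-- In G - x, the support y of the leaf x becomes a leaf with the same support as twin.
record Pinned (G : Graph n) (x y : Fin n) : Set where
  constructor pinned
  field
    {hub twin} : Fin n
    y~hub      : Adj G y hub
    hub≢x      : hub ≢ x
    only       : ∀ w → Adj G y w → w ≡ x ⊎ w ≡ hub
    leaf-twin  : Leaf G twin hub
    twin≢y     : twin ≢ y

-- Two distinct members and one non-member rule out all three kinds of trivial modules.
module-from : {P : Pred (Fin n) 0ℓ} (G : Graph n) (P? : U.Decidable P) →
              (∀ x → ¬ P x → (∀ y → P y → Adj G x y) ⊎ (∀ y → P y → ¬ Adj G x y)) →
              a ≢ b → P a → P b → ¬ P c → Decomposable G
module-from {a = a} {b = b} {c = c} {P = P} G P? uniform a≢b pa pb ¬pc =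
  M , is-module , nontrivial
  where
  M = comprehension P?
  is-module : IsModule G M
  is-module x x∉M with uniform x (x∉M ∘ ∈-comprehension⁺ P?)
  ... | inj₁ all  = inj₁ λ y y∈M → all y (∈-comprehension⁻ P? y∈M)
  ... | inj₂ none = inj₂ λ y y∈M → none y (∈-comprehension⁻ P? y∈M)
  in-M : ∀ {x} → P x → x ∈ M
  in-M = ∈-comprehension⁺ P?
  nontrivial : ¬ Trivial M
  nontrivial (inj₁ M≡⊥) = ∉⊥ (subst (a ∈_) M≡⊥ (in-M pa))
  nontrivial (inj₂ (inj₁ (q , M≡q))) = a≢b (trans (at-q pa) (sym (at-q pb)))
    where
    at-q : ∀ {x} → P x → x ≡ q
    at-q {x} p = x∈⁅y⁆⇒x≡y q (subst (x ∈_) M≡q (in-M p))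
  nontrivial (inj₂ (inj₂ M≡⊤)) = ¬pc (∈-comprehension⁻ P? (subst (c ∈_) (sym M≡⊤) ∈⊤))

-- The module is the pair `a`, `b`: the support `z` sees both, every other vertex sees neither.
twin-leaves⇒decomposable : (G : Graph n) → a ≢ b → Leaf G a z → Leaf G b z → Decomposable G
twin-leaves⇒decomposable {a = a} {b = b} {z = z} G a≢b (a~z , a-only) (b~z , b-only) =
  module-from G (λ x → (x ≟ a) ⊎-dec (x ≟ b)) uniform a≢b (inj₁ refl) (inj₂ refl)
    [ adjacent⇒≢ G a~z ∘ sym , adjacent⇒≢ G b~z ∘ sym ]
  where
  uniform : ∀ x → _ → _
  uniform x _ with x ≟ z
  ... | yes refl = inj₁ λ { _ (inj₁ refl) → adj-sym G a~z ; _ (inj₂ refl) → adj-sym G b~z }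
  ... | no x≢z   = inj₂ λ { _ (inj₁ refl) x~a → x≢z (a-only x (adj-sym G x~a))
                          ; _ (inj₂ refl) x~b → x≢z (b-only x (adj-sym G x~b)) }

prime⇒no-twin-leaves : Prime G → NoTwinLeaves G
prime⇒no-twin-leaves {G = G} (_ , all-trivial) {a} {b} leaf-a leaf-b with a ≟ b
... | yes a≡b = a≡b
... | no a≢b  =
  let M , is-module , nontrivial = twin-leaves⇒decomposable G a≢b leaf-a leaf-b
  in contradiction (all-trivial M is-module) nontrivial

-- Simple paths

-- Path G r xs: the vertices of xs form a simple path which, read backwards, starts at r.
data Path {n} (G : Graph n) (r : Fin n) : List (Fin n) → Set where
  start  : Path G r (r ∷ [])
  extend : Path G r (x ∷ xs) → Adj G x y → y ∉ₗ x ∷ xs → Path G r (y ∷ x ∷ xs)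

root∈ : Path G r xs → r ∈ₗ xs
root∈ start          = here refl
root∈ (extend p _ _) = there (root∈ p)

lookup-injective : Path G r xs → Injective _≡_ _≡_ (lookup xs)
lookup-injective start {zero} {zero} _ = refl
lookup-injective (extend p _ y∉) {zero}  {zero}  _  = refl
lookup-injective (extend p _ y∉) {zero}  {suc j} eq = contradiction (subst (_∈ₗ _) (sym eq) (∈-lookup j)) y∉
lookup-injective (extend p _ y∉) {suc i} {zero}  eq = contradiction (subst (_∈ₗ _) eq (∈-lookup i)) y∉
lookup-injective (extend p _ y∉) {suc i} {suc j} eq = cong suc (lookup-injective p eq)

path-length : {xs : List (Fin n)} → Path G r xs → length xs ≤ n
path-length p = injective⇒≤ (lookup-injective p)

truncate : Path G r xs → y ∈ₗ xs → ∃[ ys ] Path G r (y ∷ ys)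
truncate start (here refl) = _ , start
truncate p@(extend _ _ _) (here refl) = _ , p
truncate (extend p _ _) (there y∈) = truncate p y∈

-- Loop erasure: when the walk returns to a vertex of the path, the path is cut back to that vertex.
extend-by : Path G r (x ∷ xs) → Star (Adj G) x y → ∃[ ys ] Path G r (y ∷ ys)
extend-by p ε = _ , p
extend-by {xs = xs} p (_◅_ {j = z} x~z z⇝y) with ∈ₗ? _≟_ z (_ ∷ xs)
... | yes z∈ = extend-by (proj₂ (truncate p z∈)) z⇝y
... | no z∉  = extend-by (extend p x~z z∉) z⇝y

connected⇒path : Connected G → ∀ r x → ∃[ xs ] Path G r (x ∷ xs)
connected⇒path connected r x = extend-by start (connected r x)

-- A stretch of a path in the indexed form that `Cycle` asks for, running from the tip `s` back
-- towards the root. The field `within` keeps it injective when a new tip is put in front.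
record Segment (G : Graph n) (t s : Fin n) (ys : List (Fin n)) (m : ℕ) : Set where
  field
    vertex   : Fin (suc m) → Fin n
    distinct : Injective _≡_ _≡_ vertex
    step     : ∀ i → Adj G (vertex (inject₁ i)) (vertex (suc i))
    first    : vertex zero ≡ s
    last     : vertex (fromℕ m) ≡ t
    within   : ∀ i → vertex i ∈ₗ ys

segment : Path G r (y ∷ ys) → z ∈ₗ y ∷ ys → ∃[ m ] Segment G z y (y ∷ ys) m
segment {y = y} p (here refl) = 0 , record
  { vertex = λ _ → y ; distinct = λ { {zero} {zero} _ → refl } ; step = λ ()
  ; first = refl ; last = refl ; within = λ _ → here refl }
segment {G = G} {y = y} {z = z} (extend {x = x} {xs = xs} p x~y y∉) (there z∈) = suc (proj₁ s) , record
  { vertex = vertices ; distinct = inj ; step = steps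
  ; first = refl ; last = last ; within = λ { zero → here refl ; (suc i) → there (within i) } }
  where
  s = segment p z∈
  open Segment (proj₂ s)
  vertices : Fin (2 + proj₁ s) → Fin _
  vertices zero    = y
  vertices (suc i) = vertex i
  inj : Injective _≡_ _≡_ vertices
  inj {zero}  {zero}  _  = refl
  inj {zero}  {suc j} eq = contradiction (subst (_∈ₗ _) (sym eq) (within j)) y∉
  inj {suc i} {zero}  eq = contradiction (subst (_∈ₗ _) eq (within i)) y∉
  inj {suc i} {suc j} eq = cong suc (distinct eq)
  steps : ∀ i → Adj G (vertices (inject₁ i)) (vertices (suc i))
  steps zero    = subst (Adj G y) (sym first) (adj-sym G x~y)
  steps (suc i) = step i

-- The edge from `y` to `z` would close the stretch of the path between them to a cycle.
no-chord : Acyclic G → Path G r (y ∷ x ∷ xs) → Adj G y z → z ∉ₗ xs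
no-chord acyclic (extend start _ _) y~z ()
-- Matching two steps of the path lets the length of the segment reduce to `suc (suc _)`, so that it
-- has the three vertices which a cycle needs.
no-chord {G = G} acyclic p@(extend (extend _ _ _) _ _) y~z z∈xs = acyclic _ (record
  { vertex = vertex ; distinct = distinct ; step = step
  ; close = subst₂ (Adj G) (sym last) (sym first) (adj-sym G y~z) })
  where open Segment (proj₂ (segment p (there (there z∈xs))))

-- Mostly used in contrapositive form: a neighbour of the tip other than its predecessor is fresh,
-- so the path can be prolonged by it.
neighbour-on-path : Acyclic G → Path G r (y ∷ x ∷ xs) → Adj G y z → z ∈ₗ y ∷ x ∷ xs → z ≡ x
neighbour-on-path {G = G} _ _ y~z (here refl) = contradiction y~z (adj-irrefl G _)
neighbour-on-path _ _ _ (there (here z≡x)) = z≡x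
neighbour-on-path acyclic p y~z (there (there z∈)) = contradiction z∈ (no-chord acyclic p y~z)
-- Modules of trees

path₁ : Adj G x y → Path G x (y ∷ x ∷ [])
path₁ {G = G} x~y = extend start x~y λ { (here refl) → adj-irrefl G _ x~y }

no-triangle : Acyclic G → Adj G x y → Adj G y z → ¬ Adj G z x
no-triangle {G = G} acyclic x~y y~z z~x =
  no-chord acyclic
    (extend (path₁ x~y) y~z λ { (here refl) → adj-irrefl G _ y~z ; (there (here refl)) → adj-irrefl G _ z~x })
    z~x (here refl)

no-square : Acyclic G → Adj G x y → Adj G y z → Adj G z w → x ≢ z → y ≢ w → ¬ Adj G w x
no-square {G = G} acyclic x~y y~z z~w x≢z y≢w w~x =
  no-chord acyclic
    (extend
      (extend (path₁ x~y) y~z λ { (here refl) → adj-irrefl G _ y~z ; (there (here refl)) → x≢z refl })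
      z~w
      λ { (here refl) → adj-irrefl G _ z~w
        ; (there (here refl)) → y≢w refl
        ; (there (there (here refl))) → adj-irrefl G _ w~x })
    w~x (there (here refl))

crossing-edge : {G : Graph n} (M : Subset n) → Star (Adj G) x y → x ∈ M → y ∉ M →
                ∃₂ λ u v → u ∈ M × v ∉ M × Adj G u v
crossing-edge M ε x∈M x∉M = contradiction x∈M x∉M
crossing-edge {G = G} M (_◅_ {j = z} x~z z⇝y) x∈M y∉M with z ∈? M
... | yes z∈M = crossing-edge {G = G} M z⇝y z∈M y∉M
... | no z∉M  = _ , z , x∈M , z∉M , x~z

-- A proper module M is entered by an edge from some vertex v outside, which is then adjacent to
-- all of M; any further edge at M would close a triangle or a square.
tree-module-trivial : IsTree G → NoTwinLeaves G → ∀ M → IsModule G M → Trivial M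
tree-module-trivial {G = G} (connected , acyclic) no-twins M is-module with nonempty? M
... | no empty = inj₁ (Empty-unique empty)
... | yes (a , a∈M) with any? (λ b → b ∈? M ×-dec ¬? (b ≟ a))
...   | no alone = inj₂ (inj₁ (a , ⊆-antisym
            (λ {x} x∈M → subst (_∈ ⁅ a ⁆) (sym (is-a x x∈M)) (x∈⁅x⁆ a))
            (λ x∈ → subst (_∈ M) (sym (x∈⁅y⁆⇒x≡y a x∈)) a∈M)))
  where
  is-a : ∀ x → x ∈ M → x ≡ a
  is-a x x∈M = decidable-stable (x ≟ a) λ x≢a → alone (x , x∈M , x≢a)
...   | yes (b , b∈M , b≢a) with any? (λ d → ¬? (d ∈? M))
...     | no full = inj₂ (inj₂ (⊆-antisym ⊆⊤ λ {x} _ → decidable-stable (x ∈? M) λ x∉M → full (x , x∉M)))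
...     | yes (d , d∉M) with crossing-edge {G = G} M (connected a d) a∈M d∉M
...       | u , v , u∈M , v∉M , u~v =
            contradiction (no-twins (leaf b∈M a∈M b≢a) (leaf a∈M b∈M (≢-sym b≢a))) b≢a
  where
  all-adjacent : ∀ {x y z} → x ∉ M → y ∈ M → Adj G x y → z ∈ M → Adj G x z
  all-adjacent {x} {y} x∉M y∈M x~y z∈M with is-module x x∉M
  ... | inj₁ all  = all _ z∈M
  ... | inj₂ none = contradiction x~y (none y y∈M)
  v~_ : ∀ {x} → x ∈ M → Adj G v x
  v~_ = all-adjacent v∉M u∈M (adj-sym G u~v)
  leaf : ∀ {x y} → x ∈ M → y ∈ M → x ≢ y → Leaf G x v
  leaf {x} {y} x∈M y∈M x≢y = adj-sym G (v~ x∈M) , λ w x~w → decidable-stable (w ≟ v) λ w≢v → bad w x~w w≢v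
    where
    bad : ∀ w → Adj G x w → w ≢ v → _
    bad w x~w w≢v with w ∈? M
    ... | yes w∈M = no-triangle acyclic (v~ x∈M) x~w (adj-sym G (v~ w∈M))
    ... | no w∉M  = no-square acyclic (v~ x∈M) x~w (all-adjacent w∉M x∈M (adj-sym G x~w) y∈M)
                      (≢-sym w≢v) x≢y (adj-sym G (v~ y∈M))

-- Deleting a vertex

-- A view of the vertices other than `x`: matching on it replaces such a vertex by its preimage in
-- `G - x`.
data Kept {n} (x : Fin (suc n)) : Fin (suc n) → Set where
  kept : ∀ y → Kept x (punchIn x y)

kept? : {x y : Fin (suc n)} → x ≢ y → Kept x y
kept? {x = x} x≢y = subst (Kept x) (punchIn-punchOut x≢y) (kept (punchOut x≢y))

delete-path : (x : Fin (suc n)) {G : Graph (suc n)} {r : Fin n} {xs : List (Fin n)} →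
              Path (G - x) r xs → Path G (punchIn x r) (map (punchIn x) xs)
delete-path x start = start
delete-path x (extend p y~z z∉) = extend (delete-path x p) y~z λ z∈ →
  let w , w∈ , eq = ∈-map⁻ (punchIn x) z∈
  in z∉ (subst (_∈ₗ _) (sym (punchIn-injective x _ _ eq)) w∈)

delete-acyclic : (x : Fin (suc n)) {G : Graph (suc n)} → Acyclic G → Acyclic (G - x)
delete-acyclic x acyclic m cycle = acyclic m record
  { vertex   = punchIn x ∘ vertex
  ; distinct = distinct ∘ punchIn-injective x _ _
  ; step     = step
  ; close    = close
  } where open Cycle cycle

-- Deleting a leaf retracts the graph onto the rest, the leaf going to its support.
delete-leaf-connected : {G : Graph (suc n)} {x y : Fin (suc n)} →
                        Leaf G x y → Connected G → Connected (G - x)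
delete-leaf-connected {G = G} {x} {y} (x~y , x-only) connected a b =
  subst₂ (Star (Adj (G - x))) (retract-punchIn a) (retract-punchIn b)
    (kleisliStar retract edge (connected (punchIn x a) (punchIn x b)))
  where
  x≢y = adjacent⇒≢ G x~y
  retract : Fin _ → Fin _
  retract u with x ≟ u
  ... | yes _  = punchOut x≢y
  ... | no x≢u = punchOut x≢u
  retract-punchIn : ∀ u → retract (punchIn x u) ≡ u
  retract-punchIn u with x ≟ punchIn x u
  ... | yes eq  = contradiction (sym eq) (punchInᵢ≢i x u)
  ... | no x≢u = punchIn-injective x _ _ (punchIn-punchOut x≢u)
  same : ∀ {v} (x≢v : x ≢ v) → v ≡ y → punchOut x≢y ≡ punchOut x≢v
  same x≢v v≡y = punchIn-injective x _ _
    (trans (punchIn-punchOut x≢y) (trans (sym v≡y) (sym (punchIn-punchOut x≢v))))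
  edge : ∀ {u v} → Adj G u v → Star (Adj (G - x)) (retract u) (retract v)
  edge {u} {v} u~v with x ≟ u | x ≟ v
  ... | yes refl | yes refl = ε
  ... | yes refl | no x≢v = subst (Star _ _) (same x≢v (x-only v u~v)) ε
  ... | no x≢u | yes refl = subst (λ t → Star _ t _) (same x≢u (x-only u (adj-sym G u~v))) ε
  ... | no x≢u | no x≢v =
        subst₂ (Adj G) (sym (punchIn-punchOut x≢u)) (sym (punchIn-punchOut x≢v)) u~v ◅ ε

-- Removing the common neighbour x of a and b separates them; the component of a, or else (if a
-- has become isolated) everything but a, is a module.
inner⇒critical : {G : Graph (suc n)} {x a b : Fin (suc n)} → 3 ≤ n → Acyclic G →
                 Adj G x a → Adj G x b → a ≢ b → ¬ NonCritical G x
inner⇒critical {G = G} {x} {a} {b} 3≤n acyclic x~a x~b a≢b noncritical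
  with kept? (adjacent⇒≢ G x~a) | kept? (adjacent⇒≢ G x~b)
... | kept a′ | kept b′ = ¬¬-decidable (Star (Adj H′) a′) (noncritical ∘ decompose)
  where
  H′ = G - x
  separated : ¬ Star (Adj H′) a′ b′
  separated a⇝b with extend-by start a⇝b
  -- Prolonged by `x`, a path from `a` to `b` that avoids `x` would contain two neighbours of its
  -- tip, its root `a` and the predecessor `b`.
  ... | ys , p = a≢b (neighbour-on-path acyclic
                  (extend (delete-path x {G} p) (adj-sym G x~b) (λ x∈ →
                     let w , _ , eq = ∈-map⁻ (punchIn x) {xs = b′ ∷ ys} x∈ in punchInᵢ≢i x w (sym eq)))
                  x~a (there (root∈ (delete-path x {G} p))))
  decompose : U.Decidable (Star (Adj H′) a′) → Decomposable H′
  decompose C? with any? (λ d → ¬? (a′ ≟ d) ×-dec C? d)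
  ... | yes (d , a≢d , a⇝d) = module-from H′ C?
          (λ y ¬a⇝y → inj₂ λ z a⇝z y~z → ¬a⇝y (a⇝z ◅◅ (adj-sym G y~z ◅ ε)))
          a≢d ε a⇝d separated
  ... | no isolated with third-element 3≤n a′ b′
  -- The complement of `a` needs two members, `b` and a third vertex; this is where `3 ≤ n` enters.
  ...   | d , d≢a , d≢b = module-from H′ (λ y → ¬? (y ≟ a′))
          (λ y y≡a → inj₂ λ z z≢a y~z → isolated (z , ≢-sym z≢a ,
             subst (λ t → Star (Adj H′) t z) (decidable-stable (y ≟ a′) y≡a) (y~z ◅ ε)))
          d≢b d≢a (λ b≡a → a≢b (cong (punchIn x) (sym b≡a))) (λ a≢a → a≢a refl)

delete-leaf : {G : Graph (suc n)} {x : Fin (suc n)} {y z : Fin n} →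
              Adj G (punchIn x y) (punchIn x z) →
              (∀ w → Adj G (punchIn x y) w → w ≡ x ⊎ w ≡ punchIn x z) → Leaf (G - x) y z
delete-leaf {x = x} y~z only = y~z , λ w y~w →
  [ (λ eq → contradiction eq (punchInᵢ≢i x w)) , punchIn-injective x _ _ ] (only _ y~w)

pinned⇒critical : {G : Graph (suc n)} {x y : Fin (suc n)} → Leaf G x y → Pinned G x y → Critical G x
pinned⇒critical {G = G} {x} {y} (x~y , x-only)
                (pinned {hub} {twin} y~hub hub≢x only (twin~hub , twin-only) twin≢y)
  with kept? (adjacent⇒≢ G x~y) | kept? (≢-sym hub≢x) | kept? x≢twin
  where
  x≢twin : x ≢ twin
  -- If `x` were the twin, its support `y` would equal `hub`, which is a neighbour of `y`.
  x≢twin refl = adjacent⇒≢ G y~hub (sym (x-only _ twin~hub))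
... | kept y′ | kept hub′ | kept twin′ =
  twin-leaves⇒decomposable (G - x) (λ eq → twin≢y (cong (punchIn x) (sym eq)))
    (delete-leaf {G = G} {x} y~hub only) (delete-leaf {G = G} {x} twin~hub (λ w t~w → inj₂ (twin-only w t~w)))

-- `G - x` is again a tree, so only twin leaves could make it decomposable. A leaf of `G - x` is a
-- leaf of `G` unless it is `y`: twins that avoid `y` are already twins in `G`, and a twin of `y`
-- pins `x`.
unpinned⇒noncritical : {G : Graph (suc n)} {x y : Fin (suc n)} → IsTree G → NoTwinLeaves G →
                       Leaf G x y → ¬ Pinned G x y → NonCritical G x
unpinned⇒noncritical {G = G} {x} {y} (connected , acyclic) no-twins leaf@(x~y , x-only) ¬pinned
                     (M , is-module , nontrivial) =
  nontrivial (tree-module-trivial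
    (delete-leaf-connected {G = G} leaf connected , delete-acyclic x {G} acyclic) no-twins′ M is-module)
  where
  support : ∀ {a z} → Leaf (G - x) a z → Adj G (punchIn x a) x → punchIn x a ≡ y
  support _ a~x = x-only _ (adj-sym G a~x)
  nearly-leaf : ∀ {a z} → Leaf (G - x) a z → ∀ w → Adj G (punchIn x a) w → w ≡ x ⊎ w ≡ punchIn x z
  nearly-leaf (_ , a-only) w a~w with x ≟ w
  ... | yes refl = inj₁ refl
  ... | no x≢w with kept? x≢w
  ...   | kept w′ = inj₂ (cong (punchIn x) (a-only w′ a~w))
  leaf-in : ∀ {a z} → Leaf (G - x) a z → ¬ Adj G (punchIn x a) x → Leaf G (punchIn x a) (punchIn x z)
  leaf-in leaf-a@(a~z , _) a≁x = a~z , λ w a~w →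
    [ (λ { refl → contradiction a~w a≁x }) , id ] (nearly-leaf leaf-a w a~w)
  pinned-by : ∀ {a b z} → Leaf (G - x) a z → Leaf (G - x) b z → a ≢ b →
              Adj G (punchIn x a) x → ¬ Adj G (punchIn x b) x → Pinned G x (punchIn x a)
  pinned-by {z = z} leaf-a leaf-b a≢b a~x b≁x = pinned (proj₁ leaf-a) (punchInᵢ≢i x z)
    (nearly-leaf leaf-a) (leaf-in leaf-b b≁x) (λ eq → a≢b (sym (punchIn-injective x _ _ eq)))
  no-twins′ : NoTwinLeaves (G - x)
  no-twins′ {a} {b} leaf-a leaf-b with a ≟ b
  ... | yes a≡b = a≡b
  ... | no a≢b with adj? G (punchIn x a) x | adj? G (punchIn x b) x
  ...   | yes a~x | yes b~x =
            punchIn-injective x _ _ (trans (support leaf-a a~x) (sym (support leaf-b b~x)))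
  ...   | yes a~x | no b≁x = contradiction
            (subst (Pinned G x) (support leaf-a a~x) (pinned-by leaf-a leaf-b a≢b a~x b≁x)) ¬pinned
  ...   | no a≁x | yes b~x = contradiction
            (subst (Pinned G x) (support leaf-b b~x) (pinned-by leaf-b leaf-a (≢-sym a≢b) b~x a≁x)) ¬pinned
  ...   | no a≁x | no b≁x = punchIn-injective x _ _ (no-twins (leaf-in leaf-a a≁x) (leaf-in leaf-b b≁x))

-- Connectedness provides one neighbour, and `inner⇒critical` excludes a second one.
noncritical⇒leaf : {G : Graph n} {x : Fin n} → 4 ≤ n → IsTree G → NonCritical G x → ∃[ y ] Leaf G x y
noncritical⇒leaf {suc n} {G} {x} (s≤s 3≤n) (connected , acyclic) noncritical
  with third-element (m≤n⇒m≤1+n 3≤n) x x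
... | d , d≢x , _ with connected x d
...   | ε = contradiction refl d≢x
...   | _◅_ {j = y} x~y _ = y , x~y , λ z x~z → decidable-stable (z ≟ y) λ z≢y →
          inner⇒critical {G = G} 3≤n acyclic x~y x~z (≢-sym z≢y) noncritical
-- Ends of long paths

-- The last three vertices of a path that cannot be prolonged, even after exchanging its tip for
-- another neighbour of the joint.
record DeepEnd (G : Graph n) (r : Fin n) (depth : ℕ) : Set where
  field
    {tip joint hip} : Fin n
    {rest} : List (Fin n)
    path   : Path G r (tip ∷ joint ∷ hip ∷ rest)
    leaf   : Leaf G tip joint
    only   : ∀ y → Adj G joint y → y ≡ tip ⊎ y ≡ hip
    deep   : depth ≤ length rest

-- While some neighbour `x ≢ v` of the joint `w` has a neighbour `y ≢ w`, the path is rerouted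
-- through `x` and `y` and grows by one vertex. When this stops, all neighbours of `w` except `v`
-- are leaves at `w`, so by `no-twins` there is just one.
deep-end : {G : Graph n} → Acyclic G → NoTwinLeaves G → Path G r (z ∷ w ∷ v ∷ xs) → DeepEnd G r (length xs)
deep-end {n = n} {r = r} {G = G} acyclic no-twins p = go n p (ℕ.m≤m+n n _)
  where
  -- The sum of fuel and length never falls below `n`; with no fuel left, the path would have more
  -- than `n` vertices.
  go : ∀ {z w v xs} fuel → Path G r (z ∷ w ∷ v ∷ xs) → n ≤ fuel + length xs → DeepEnd G r (length xs)
  go {xs = xs} zero p n≤ = contradiction (≤-trans (path-length p) n≤) (ℕ.<⇒≱ (s≤s (ℕ.m≤n+m (length xs) 2)))
  go {z} {w} {v} {xs} (suc fuel) p@(extend q w~z z∉) n≤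
    with any? (λ x → any? λ y → adj? G w x ×-dec ¬? (x ≟ v) ×-dec adj? G x y ×-dec ¬? (y ≟ w))
  ... | yes (x , y , w~x , x≢v , x~y , y≢w) =
          record { DeepEnd d ; deep = ≤-trans (ℕ.n≤1+n _) (DeepEnd.deep d) }
    where
    p′ : Path G r (x ∷ w ∷ v ∷ xs)
    p′ = extend q w~x (x≢v ∘ neighbour-on-path acyclic q w~x)
    d = go fuel (extend p′ x~y (y≢w ∘ neighbour-on-path acyclic p′ x~y))
              (subst (n ≤_) (sym (+-suc fuel _)) n≤)
  ... | no maximal = record { path = p ; leaf = leaf-z ; only = only ; deep = ≤-refl }
    where
    leaf-at-w : ∀ x → Adj G w x → x ≢ v → Leaf G x w
    leaf-at-w x w~x x≢v = adj-sym G w~x , λ y x~y → decidable-stable (y ≟ w) λ y≢w →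
      maximal (x , y , w~x , x≢v , x~y , y≢w)
    leaf-z : Leaf G z w
    leaf-z = leaf-at-w z w~z λ { refl → z∉ (there (here refl)) }
    only : ∀ y → Adj G w y → y ≡ z ⊎ y ≡ v
    only y w~y with y ≟ v
    ... | yes y≡v = inj₂ y≡v
    ... | no y≢v  = inj₁ (no-twins (leaf-at-w y w~y y≢v) leaf-z)

-- Spiders

-- The model has `e` legs of length one and `m` legs of length two. The trees `P 4 t` are the case
-- `e = 1`, `m = suc t`; the trees `A[2* m +1]` are the case `e = 0`.
data SpiderVertex (e m : ℕ) : Set where
  centre  : SpiderVertex e m
  pendant : Fin e → SpiderVertex e m
  knee    : Fin m → SpiderVertex e m
  foot    : Fin m → SpiderVertex e m

data SpiderEdge {e m : ℕ} : Rel (SpiderVertex e m) 0ℓ where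
  short : ∀ j → SpiderEdge centre (pendant j)
  thigh : ∀ i → SpiderEdge centre (knee i)
  shin  : ∀ i → SpiderEdge (knee i) (foot i)

SpiderAdj : Rel (SpiderVertex e m) 0ℓ
SpiderAdj = SymClosure SpiderEdge

-- An isomorphism from the model onto `G`, stored as a labelling so that vertices of `G` can be
-- analysed by matching on `SpiderVertex`.
record Spider (e m : ℕ) {n} (G : Graph n) : Set where
  field
    place      : SpiderVertex e m → Fin n
    injective  : Injective _≡_ _≡_ place
    surjective : ∀ x → ∃[ s ] place s ≡ x
    adjacency  : ∀ s t → Adj G (place s) (place t) ⇔ SpiderAdj s t

  index : Fin n → SpiderVertex e m
  index x = proj₁ (surjective x)

  place-index : ∀ x → place (index x) ≡ x
  place-index x = proj₂ (surjective x)

  index-place : ∀ s → index (place s) ≡ s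
  index-place s = injective (place-index (place s))

  edge : ∀ {s t} → SpiderAdj s t → Adj G (place s) (place t)
  edge = Equivalence.from (adjacency _ _)

  neighbour : ∀ s {x} → Adj G (place s) x → ∃[ t ] x ≡ place t × SpiderAdj s t
  neighbour s {x} s~x = index x , sym (place-index x) ,
    Equivalence.to (adjacency _ _) (subst (Adj G (place s)) (sym (place-index x)) s~x)

  pendant-leaf : ∀ j → Leaf G (place (pendant j)) (place centre)
  pendant-leaf j = edge (bwd (short j)) , only
    where
    only : ∀ z → Adj G (place (pendant j)) z → z ≡ place centre
    only z ~z with neighbour (pendant j) ~z
    ... | _ , eq , bwd (short _) = eq

  foot-leaf : ∀ i → Leaf G (place (foot i)) (place (knee i))
  foot-leaf i = edge (bwd (shin i)) , only
    where
    only : ∀ z → Adj G (place (foot i)) z → z ≡ place (knee i)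
    only z ~z with neighbour (foot i) ~z
    ... | _ , eq , bwd (shin _) = eq

  knee-neighbour : ∀ i z → Adj G (place (knee i)) z → z ≡ place (foot i) ⊎ z ≡ place centre
  knee-neighbour i z ~z with neighbour (knee i) ~z
  ... | _ , eq , fwd (shin _)  = inj₁ eq
  ... | _ , eq , bwd (thigh _) = inj₂ eq

spiders-isomorphic : {G : Graph k} {H : Graph n} → Spider e m G → Spider e m H → G ≃ H
spiders-isomorphic {G = G} {H = H} S T = record
  { bijection = mk↔ₛ′ (T.place ∘ S.index) (S.place ∘ T.index)
      (λ y → trans (cong T.place (S.index-place (T.index y))) (T.place-index y))
      (λ x → trans (cong S.place (T.index-place (S.index x))) (S.place-index x))
  ; preserves = λ x y → mk⇔
      (λ x~y → T.edge (Equivalence.to (S.adjacency _ _)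
                 (subst₂ (Adj G) (sym (S.place-index x)) (sym (S.place-index y)) x~y)))
      (λ x~y → subst₂ (Adj G) (S.place-index x) (S.place-index y)
                 (S.edge (Equivalence.to (T.adjacency _ _) x~y)))
  }
  where
  module S = Spider S
  module T = Spider T

spider-transport : {G : Graph k} {H : Graph n} → G ≃ H → Spider e m H → Spider e m G
spider-transport {G = G} {H = H} G≃H S = record
  { place      = from ∘ place
  ; injective  = λ {s} {t} eq → injective (trans (sym (strictlyInverseˡ (place s)))
                   (trans (cong to eq) (strictlyInverseˡ (place t))))
  ; surjective = λ x → index (to x) , trans (cong from (place-index (to x))) (strictlyInverseʳ x)
  ; adjacency  = λ s t → mk⇔
      (λ s~t → Equivalence.to (adjacency s t)
                 (subst₂ (Adj H) (strictlyInverseˡ (place s)) (strictlyInverseˡ (place t)) (Equivalence.to (preserves _ _) s~t)))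
      (λ s~t → Equivalence.from (preserves _ _)
                 (subst₂ (Adj H) (sym (strictlyInverseˡ (place s))) (sym (strictlyInverseˡ (place t)))
                   (edge s~t)))
  }
  where
  open _≃_ G≃H
  open Inverse bijection using (to; from; strictlyInverseˡ; strictlyInverseʳ)
  open Spider S

-- The trees P and A as spiders.

module _ (f : ℕ → ℕ) {E : Rel ℕ 0ℓ} (E? : Decidable E) (loopless : ∀ a → ¬ E a a)
         (number : SpiderVertex e m → ℕ)
         (number-injective : Injective _≡_ _≡_ number)
         (number< : ∀ s → number s < n)
         (number-surjective : ∀ {x} → x < n → ∃[ s ] number s ≡ x)
         (edge⁺ : ∀ {s t} → SpiderEdge s t → SymClosure E (f (number s)) (f (number t)))
         (edge⁻ : ∀ {s t} → E (f (number s)) (f (number t)) → SpiderAdj s t)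
         where

  -- `number` counts the model's vertices from 0, and `f` turns positions into labels: `suc` for
  -- `P`, the identity for `A`. Both edge conditions allow a reversal, since the orientations chosen
  -- in `E` and in `SpiderEdge` may differ.
  numbered-spider : Spider e m (fromEdges {n} (f ∘ toℕ) E E? loopless)
  numbered-spider = record
    { place      = place
    ; injective  = λ {s} {t} eq → number-injective
                     (trans (sym (toℕ-place s)) (trans (cong toℕ eq) (toℕ-place t)))
    ; surjective = λ x → let s , eq = number-surjective (toℕ<n x)
                         in s , toℕ-injective (trans (toℕ-place s) eq)
    ; adjacency  = λ s t → mk⇔
        (λ s~t → adj⁻ (subst₂ (SymClosure E) (cong f (toℕ-place s)) (cong f (toℕ-place t)) s~t))
        (λ s~t → subst₂ (SymClosure E) (cong f (sym (toℕ-place s))) (cong f (sym (toℕ-place t))) (adj⁺ s~t))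
    }
    where
    place : SpiderVertex e m → Fin n
    place s = fromℕ< (number< s)
    toℕ-place : ∀ s → toℕ (place s) ≡ number s
    toℕ-place s = toℕ-fromℕ< (number< s)
    adj⁺ : ∀ {s t} → SpiderAdj s t → SymClosure E (f (number s)) (f (number t))
    adj⁺ (fwd st) = edge⁺ st
    adj⁺ (bwd ts) = symmetric E (edge⁺ ts)
    adj⁻ : ∀ {s t} → SymClosure E (f (number s)) (f (number t)) → SpiderAdj s t
    adj⁻ (fwd st) = edge⁻ st
    adj⁻ (bwd ts) = symmetric _ (edge⁻ ts)

-- P 4 t on its labels minus one; knee zero and foot zero are the last two vertices of the path.
P-number : ∀ t → SpiderVertex 1 (suc t) → ℕ
P-number t (pendant _)    = 2 * t
P-number t centre         = 1 + 2 * t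
P-number t (knee zero)    = 2 + 2 * t
P-number t (foot zero)    = 3 + 2 * t
P-number t (foot (suc i)) = 2 * toℕ i
P-number t (knee (suc i)) = 1 + 2 * toℕ i

-- Makes room for a new leg with the numbers 0 and 1; all other numbers grow by two. This sets up
-- induction on `t` for the numbering and its inverse.
shift : ∀ {t} → SpiderVertex 1 (suc t) → SpiderVertex 1 (suc (suc t))
shift centre         = centre
shift (pendant j)    = pendant j
shift (knee zero)    = knee zero
shift (foot zero)    = foot zero
shift (knee (suc i)) = knee (suc (suc i))
shift (foot (suc i)) = foot (suc (suc i))

shift-elim : ∀ {t} (Q : SpiderVertex 1 (suc (suc t)) → Set) →
             Q (foot (suc zero)) → Q (knee (suc zero)) → (∀ s → Q (shift s)) → ∀ s → Q s
shift-elim Q q₀ q₁ q centre               = q centre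
shift-elim Q q₀ q₁ q (pendant j)          = q (pendant j)
shift-elim Q q₀ q₁ q (knee zero)          = q (knee zero)
shift-elim Q q₀ q₁ q (foot zero)          = q (foot zero)
shift-elim Q q₀ q₁ q (knee (suc zero))    = q₁
shift-elim Q q₀ q₁ q (foot (suc zero))    = q₀
shift-elim Q q₀ q₁ q (knee (suc (suc i))) = q (knee (suc i))
shift-elim Q q₀ q₁ q (foot (suc (suc i))) = q (foot (suc i))

P-number-shift : ∀ t s → P-number (suc t) (shift s) ≡ 2 + P-number t s
P-number-shift t centre         = cong (1 +_) (ℕ.*-suc 2 t)
P-number-shift t (pendant j)    = ℕ.*-suc 2 t
P-number-shift t (knee zero)    = cong (2 +_) (ℕ.*-suc 2 t)
P-number-shift t (foot zero)    = cong (3 +_) (ℕ.*-suc 2 t)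
P-number-shift t (knee (suc i)) = cong (1 +_) (ℕ.*-suc 2 (toℕ i))
P-number-shift t (foot (suc i)) = ℕ.*-suc 2 (toℕ i)

P-vertex : ∀ t → ℕ → SpiderVertex 1 (suc t)
P-vertex zero    0             = pendant zero
P-vertex zero    1             = centre
P-vertex zero    2             = knee zero
-- Meant for 3; larger arguments are out of range and receive the same default.
P-vertex zero    _             = foot zero
P-vertex (suc t) 0             = foot (suc zero)
P-vertex (suc t) 1             = knee (suc zero)
P-vertex (suc t) (suc (suc x)) = shift (P-vertex t x)

P-vertex-number : ∀ t s → P-vertex t (P-number t s) ≡ s
P-vertex-number zero centre         = refl
P-vertex-number zero (pendant zero) = refl
P-vertex-number zero (knee zero)    = refl
P-vertex-number zero (foot zero)    = refl
P-vertex-number (suc t) = shift-elim _ refl refl λ s →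
  trans (cong (P-vertex (suc t)) (P-number-shift t s)) (cong shift (P-vertex-number t s))

P-size : ∀ t → 2 * suc t + 4 ≡ 2 + (2 * t + 4)
P-size t = cong (_+ 4) (ℕ.*-suc 2 t)

P-number-vertex : ∀ t {x} → x < 2 * t + 4 → P-number t (P-vertex t x) ≡ x
P-number-vertex zero {0} _ = refl
P-number-vertex zero {1} _ = refl
P-number-vertex zero {2} _ = refl
P-number-vertex zero {3} _ = refl
P-number-vertex zero {suc (suc (suc (suc _)))} (s≤s (s≤s (s≤s (s≤s ()))))
P-number-vertex (suc t) {0} _ = refl
P-number-vertex (suc t) {1} _ = refl
P-number-vertex (suc t) {suc (suc x)} x< = trans (P-number-shift t (P-vertex t x))
  (cong (2 +_) (P-number-vertex t (s≤s⁻¹ (s≤s⁻¹ (subst (2 + x <_) (P-size t) x<)))))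

P-number< : ∀ t s → P-number t s < 2 * t + 4
P-number< zero centre         = s≤s (s≤s z≤n)
P-number< zero (pendant zero) = s≤s z≤n
P-number< zero (knee zero)    = s≤s (s≤s (s≤s z≤n))
P-number< zero (foot zero)    = ≤-refl
P-number< (suc t) = shift-elim _
  (subst (0 <_) (sym (P-size t)) (s≤s z≤n)) (subst (1 <_) (sym (P-size t)) (s≤s (s≤s z≤n)))
  λ s → subst₂ _<_ (sym (P-number-shift t s)) (sym (P-size t)) (s≤s (s≤s (P-number< t s)))

P-number-injective : ∀ t → Injective _≡_ _≡_ (P-number t)
P-number-injective t {s} {s′} eq =
  trans (sym (P-vertex-number t s)) (trans (cong (P-vertex t) eq) (P-vertex-number t s′))

-- The path on the labels `2t+1` to `2t+4` runs through the pendant, the centre, `knee zero` and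
-- `foot zero`. The labels `2i-1` and `2i` are the foot and the knee of another leg.
P-edge⁺ : ∀ t {s s′} → SpiderEdge s s′ → SymClosure (PEdge 4 t) (suc (P-number t s)) (suc (P-number t s′))
P-edge⁺ t (short j) = bwd (inj₁ (1 , (s≤s z≤n , s≤s z≤n) , +-comm 1 _ ,
  trans (+-comm 1 _) (cong (_+ 1) (+-comm 1 _))))
P-edge⁺ t (thigh zero) = fwd (inj₁ (2 , (s≤s z≤n , s≤s (s≤s z≤n)) , +-comm 2 _ ,
  trans (+-comm 1 _) (cong (_+ 1) (+-comm 2 _))))
P-edge⁺ t (shin zero) = fwd (inj₁ (3 , (s≤s z≤n , s≤s (s≤s (s≤s z≤n))) , +-comm 3 _ ,
  trans (+-comm 1 _) (cong (_+ 1) (+-comm 3 _))))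
P-edge⁺ t (thigh (suc i)) = fwd (inj₂ (inj₂ (suc (toℕ i) , (s≤s z≤n , toℕ<n i) ,
  +-comm 2 _ , sym (ℕ.*-suc 2 (toℕ i)))))
P-edge⁺ t (shin (suc i)) = bwd (inj₂ (inj₁ (suc (toℕ i) , (s≤s z≤n , toℕ<n i) ,
  cong (_∸ 1) (sym (ℕ.*-suc 2 (toℕ i))) , sym (ℕ.*-suc 2 (toℕ i)))))

P-edge⁻ : ∀ t {s s′} → PEdge 4 t (suc (P-number t s)) (suc (P-number t s′)) → SpiderAdj s s′
P-edge⁻ t {s} {s′} = λ where
    (inj₁ (1 , _ , p , q)) → subst₂ SpiderAdj
      (at (pendant zero) (trans p (+-comm _ 1)))
      (at centre (trans q (trans (cong (_+ 1) (+-comm _ 1)) (+-comm _ 1)))) (bwd (short zero))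
    (inj₁ (2 , _ , p , q)) → subst₂ SpiderAdj
      (at centre (trans p (+-comm _ 2)))
      (at (knee zero) (trans q (trans (cong (_+ 1) (+-comm _ 2)) (+-comm _ 1)))) (fwd (thigh zero))
    (inj₁ (3 , _ , p , q)) → subst₂ SpiderAdj
      (at (knee zero) (trans p (+-comm _ 3)))
      (at (foot zero) (trans q (trans (cong (_+ 1) (+-comm _ 3)) (+-comm _ 1)))) (fwd (shin zero))
    (inj₁ (suc (suc (suc (suc _))) , (_ , s≤s (s≤s (s≤s ()))) , _))
    (inj₂ (inj₁ (suc i , (_ , i<t) , p , q))) → subst₂ SpiderAdj
      (at (foot (suc (fromℕ< i<t))) (trans p (trans (cong (_∸ 1) (ℕ.*-suc 2 i)) (double i<t 1))))
      (at (knee (suc (fromℕ< i<t))) (trans q (trans (ℕ.*-suc 2 i) (double i<t 2))))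
      (bwd (shin _))
    (inj₂ (inj₂ (suc i , (_ , i<t) , p , q))) → subst₂ SpiderAdj
      (at centre (trans p (+-comm _ 2)))
      (at (knee (suc (fromℕ< i<t))) (trans q (trans (ℕ.*-suc 2 i) (double i<t 2))))
      (fwd (thigh _))
  where
  at : ∀ {s} s′ → suc (P-number t s) ≡ suc (P-number t s′) → s′ ≡ s
  at s′ eq = P-number-injective t (sym (ℕ.suc-injective eq))
  double : ∀ {i} (i<t : i < t) k → k + 2 * i ≡ k + 2 * toℕ (fromℕ< i<t)
  double i<t k = cong (λ i → k + 2 * i) (sym (toℕ-fromℕ< i<t))

P-spider : ∀ t → Spider 1 (suc t) (P 4 t)
P-spider t = numbered-spider suc (PEdge? 4 t) (PEdge-loopless 4 t)
  (P-number t) (P-number-injective t) (P-number< t)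
  (λ {x} x< → P-vertex t x , P-number-vertex t x<) (P-edge⁺ t) (P-edge⁻ t)

A-number : ∀ m → SpiderVertex 0 m → ℕ
A-number m centre   = 0
A-number m (knee i) = suc (toℕ i)
A-number m (foot i) = suc (toℕ i) + m

A-number-injective : ∀ m → Injective _≡_ _≡_ (A-number m)
A-number-injective m {centre} {centre} eq = refl
A-number-injective m {knee i} {knee j} eq = cong knee (toℕ-injective (ℕ.suc-injective eq))
A-number-injective m {foot i} {foot j} eq =
  cong foot (toℕ-injective (ℕ.+-cancelʳ-≡ m _ _ (ℕ.suc-injective eq)))
A-number-injective m {knee i} {foot j} eq =
  contradiction (ℕ.suc-injective eq) (ℕ.<⇒≢ (≤-trans (toℕ<n i) (ℕ.m≤n+m m _)))
A-number-injective m {foot i} {knee j} eq =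
  contradiction (sym (ℕ.suc-injective eq)) (ℕ.<⇒≢ (≤-trans (toℕ<n j) (ℕ.m≤n+m m _)))

A-size : ∀ m → 2 * m + 1 ≡ suc (m + m)
A-size m = trans (+-comm _ 1) (cong (λ k → suc (m + k)) (ℕ.+-identityʳ m))

A-number< : ∀ m s → A-number m s < 2 * m + 1
A-number< m s = subst (A-number m s <_) (sym (A-size m)) (bound s)
  where
  bound : ∀ s → A-number m s < suc (m + m)
  bound centre   = s≤s z≤n
  bound (knee i) = s≤s (≤-trans (toℕ<n i) (ℕ.m≤m+n m m))
  bound (foot i) = s≤s (ℕ.+-monoˡ-≤ m (toℕ<n i))

A-number-surjective : ∀ m {x} → x < 2 * m + 1 → ∃[ s ] A-number m s ≡ x
A-number-surjective m {zero} _ = centre , refl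
A-number-surjective m {suc x} x< with x ℕ.<? m
... | yes x<m = knee (fromℕ< x<m) , cong suc (toℕ-fromℕ< x<m)
... | no x≮m  = foot (fromℕ< x∸m<m) , cong suc (trans (cong (_+ m) (toℕ-fromℕ< x∸m<m)) (ℕ.m∸n+n≡m m≤x))
  where
  m≤x = ℕ.≮⇒≥ x≮m
  x∸m<m : x ∸ m < m
  x∸m<m = ℕ.+-cancelʳ-< m _ _ (subst (_< m + m) (sym (ℕ.m∸n+n≡m m≤x))
    (s≤s⁻¹ (subst (suc x <_) (A-size m) x<)))

A-edge⁺ : ∀ m {s t} → SpiderEdge s t → SymClosure (AEdge m) (A-number m s) (A-number m t)
A-edge⁺ m (thigh i) = fwd (inj₁ (suc (toℕ i) , (s≤s z≤n , toℕ<n i) , refl , refl))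
A-edge⁺ m (shin i)  = fwd (inj₂ (suc (toℕ i) , (s≤s z≤n , toℕ<n i) , refl , refl))

A-edge⁻ : ∀ m {s t} → AEdge m (A-number m s) (A-number m t) → SpiderAdj s t
A-edge⁻ m = λ where
    (inj₁ (suc i , (_ , i<m) , p , q)) → subst₂ SpiderAdj
      (at centre p) (at (knee (fromℕ< i<m)) (trans q (cong suc (sym (toℕ-fromℕ< i<m))))) (fwd (thigh _))
    (inj₂ (suc i , (_ , i<m) , p , q)) → subst₂ SpiderAdj
      (at (knee (fromℕ< i<m)) (trans p (cong suc (sym (toℕ-fromℕ< i<m)))))
      (at (foot (fromℕ< i<m)) (trans q (cong (λ i → suc i + m) (sym (toℕ-fromℕ< i<m))))) (fwd (shin _))
  where
  at : ∀ {s} s′ → A-number m s ≡ A-number m s′ → s′ ≡ s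
  at s′ eq = A-number-injective m (sym eq)

A-spider : ∀ m → Spider 0 m A[2* m +1]
A-spider m = numbered-spider id (AEdge? m) (AEdge-loopless m)
  (A-number m) (A-number-injective m) (A-number< m)
  (A-number-surjective m) (A-edge⁺ m) (A-edge⁻ m)

-- Trees of depth at most two are spiders.

module _ {G : Graph n} (connected : Connected G) (acyclic : Acyclic G) (no-twins : NoTwinLeaves G)
         (c : Fin n) (shallow : ∀ {x y z w xs} → ¬ Path G c (x ∷ y ∷ z ∷ w ∷ xs))
         (pend : Fin e → Fin n) (pend-injective : Injective _≡_ _≡_ pend)
         (pend-leaf : ∀ j → Leaf G (pend j) c)
         (pend-exhaustive : ∀ {x} → Leaf G x c → ∃[ j ] pend j ≡ x)
         where

  private
    Knee : Fin n → Set
    Knee v = Adj G c v × ¬ Leaf G v c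

    Knee? : U.Decidable Knee
    Knee? v = adj? G c v ×-dec ¬? (leaf? G v c)

    Foot : Fin n → Fin n → Set
    Foot v w = Adj G v w × w ≢ c

    foot-of : ∀ {v} → Knee v → ∃[ w ] Foot v w
    foot-of {v} (c~v , ¬leaf) with any? (λ w → adj? G v w ×-dec ¬? (w ≟ c))
    ... | yes w = w
    ... | no ∄w = contradiction
            (adj-sym G c~v , λ w v~w → decidable-stable (w ≟ c) λ w≢c → ∄w (w , v~w , w≢c)) ¬leaf

    -- Another neighbour of `w` would prolong the path `c`, `v`, `w` beyond the permitted depth.
    foot-is-leaf : ∀ {v w} → Adj G c v → Foot v w → Leaf G w v
    foot-is-leaf {v} {w} c~v (v~w , w≢c) = adj-sym G v~w , λ x w~x →
      decidable-stable (x ≟ v) λ x≢v → shallow (extend path₂ w~x (x≢v ∘ neighbour-on-path acyclic path₂ w~x))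
      where
      path₂ : Path G c (w ∷ v ∷ c ∷ [])
      path₂ = extend (path₁ c~v) v~w (w≢c ∘ neighbour-on-path acyclic (path₁ c~v) v~w)

    open Enumeration (enumerate (comprehension Knee?))

    is-knee : ∀ i → Knee (elem i)
    is-knee i = ∈-comprehension⁻ Knee? (member i)

    place : SpiderVertex e _ → Fin n
    place centre      = c
    place (pendant j) = pend j
    place (knee i)    = elem i
    place (foot i)    = proj₁ (foot-of (is-knee i))

    is-foot : ∀ i → Foot (elem i) (place (foot i))
    is-foot i = proj₂ (foot-of (is-knee i))

    foot-leaf : ∀ i → Leaf G (place (foot i)) (elem i)
    foot-leaf i = foot-is-leaf (proj₁ (is-knee i)) (is-foot i)

    foot-unique : ∀ i {x} → Foot (elem i) x → x ≡ place (foot i)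
    foot-unique i f = no-twins (foot-is-leaf (proj₁ (is-knee i)) f) (foot-leaf i)

    centre≢pendant : ∀ j → c ≢ pend j
    centre≢pendant j = ≢-sym (adjacent⇒≢ G (proj₁ (pend-leaf j)))

    centre≢knee : ∀ i → c ≢ elem i
    centre≢knee i = adjacent⇒≢ G (proj₁ (is-knee i))

    centre≢foot : ∀ i → c ≢ place (foot i)
    centre≢foot i = ≢-sym (proj₂ (is-foot i))

    pendant≢knee : ∀ j i → pend j ≢ elem i
    pendant≢knee j i eq = proj₂ (is-knee i) (subst (λ x → Leaf G x c) eq (pend-leaf j))

    pendant≢foot : ∀ j i → pend j ≢ place (foot i)
    pendant≢foot j i eq = centre≢knee i
      (sym (proj₂ (pend-leaf j) _ (subst (λ x → Adj G x (elem i)) (sym eq) (proj₁ (foot-leaf i)))))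

    knee≢foot : ∀ i i′ → elem i ≢ place (foot i′)
    knee≢foot i i′ eq = centre≢knee i′
      (proj₂ (foot-leaf i′) c (subst (λ x → Adj G x c) eq (adj-sym G (proj₁ (is-knee i)))))

    place-injective : Injective _≡_ _≡_ place
    place-injective {centre}    {centre}    eq = refl
    place-injective {centre}    {pendant j} eq = contradiction eq (centre≢pendant j)
    place-injective {centre}    {knee i}    eq = contradiction eq (centre≢knee i)
    place-injective {centre}    {foot i}    eq = contradiction eq (centre≢foot i)
    place-injective {pendant j} {centre}    eq = contradiction (sym eq) (centre≢pendant j)
    place-injective {pendant j} {pendant _} eq = cong pendant (pend-injective eq)
    place-injective {pendant j} {knee i}    eq = contradiction eq (pendant≢knee j i)
    place-injective {pendant j} {foot i}    eq = contradiction eq (pendant≢foot j i)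
    place-injective {knee i}    {centre}    eq = contradiction (sym eq) (centre≢knee i)
    place-injective {knee i}    {pendant j} eq = contradiction (sym eq) (pendant≢knee j i)
    place-injective {knee i}    {knee _}    eq = cong knee (injective eq)
    place-injective {knee i}    {foot i′}   eq = contradiction eq (knee≢foot i i′)
    place-injective {foot i}    {centre}    eq = contradiction (sym eq) (centre≢foot i)
    place-injective {foot i}    {pendant j} eq = contradiction (sym eq) (pendant≢foot j i)
    place-injective {foot i}    {knee i′}   eq = contradiction (sym eq) (knee≢foot i′ i)
    place-injective {foot i}    {foot i′}   eq = cong foot (injective
      (proj₂ (foot-leaf i′) _ (subst (λ x → Adj G x (elem i)) eq (proj₁ (foot-leaf i)))))

    -- The length of a path from `c` to `x` decides the kind of `x`: the centre itself, then a
    -- pendant or a knee, then a foot.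
    place-surjective : ∀ x → ∃[ s ] place s ≡ x
    place-surjective x with connected⇒path connected c x
    ... | [] , start = centre , refl
    ... | c ∷ [] , extend start c~x _ with leaf? G x c
    ...   | yes leaf = let j , eq = pend-exhaustive leaf in pendant j , eq
    ...   | no ¬leaf = let i , eq = exhaustive (∈-comprehension⁺ Knee? (c~x , ¬leaf)) in knee i , eq
    place-surjective x | v ∷ c ∷ [] , extend (extend start c~v _) v~x x∉
      with exhaustive (∈-comprehension⁺ Knee? (c~v , λ leaf → x≢c (proj₂ leaf x v~x)))
      where
      x≢c : x ≢ c
      x≢c x≡c = x∉ (there (here x≡c))
    ... | i , refl = foot i , sym (foot-unique i (v~x , λ x≡c → x∉ (there (here x≡c))))
    place-surjective x | v ∷ w ∷ y ∷ ys , p = contradiction p shallow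

    edge⁺ : ∀ {s t} → SpiderEdge s t → Adj G (place s) (place t)
    edge⁺ (short j) = adj-sym G (proj₁ (pend-leaf j))
    edge⁺ (thigh i) = proj₁ (is-knee i)
    edge⁺ (shin i)  = proj₁ (is-foot i)

    adj⁺ : ∀ {s t} → SpiderAdj s t → Adj G (place s) (place t)
    adj⁺ (fwd st) = edge⁺ st
    adj⁺ (bwd ts) = adj-sym G (edge⁺ ts)

    adj⁻ : ∀ s t → Adj G (place s) (place t) → SpiderAdj s t
    adj⁻ (pendant j) t s~t with place-injective {t} {centre} (proj₂ (pend-leaf j) _ s~t)
    ... | refl = bwd (short j)
    adj⁻ (foot i) t s~t with place-injective {t} {knee i} (proj₂ (foot-leaf i) _ s~t)
    ... | refl = bwd (shin i)
    adj⁻ (knee i) t s~t with place t ≟ c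
    ... | yes eq with place-injective {t} {centre} eq
    ...   | refl = bwd (thigh i)
    adj⁻ (knee i) t s~t | no t≢c with place-injective {t} {foot i} (foot-unique i (s~t , t≢c))
    ...   | refl = fwd (shin i)
    adj⁻ centre centre      s~t = contradiction s~t (adj-irrefl G c)
    adj⁻ centre (pendant j) s~t = fwd (short j)
    adj⁻ centre (knee i)    s~t = fwd (thigh i)
    adj⁻ centre (foot i)    s~t =
      contradiction (proj₂ (foot-leaf i) c (adj-sym G s~t)) (centre≢knee i)

  shallow-spider : ∃[ m ] Σ (Spider e m G) λ S → ∀ j → Spider.place S (pendant j) ≡ pend j
  shallow-spider = _ , record
    { place = place ; injective = place-injective ; surjective = place-surjective
    ; adjacency = λ s t → mk⇔ (adj⁻ s t) adj⁺ } , λ _ → refl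

-- Non-critical vertices of spiders

module _ {G : Graph n} (S : Spider e (2 + m) G) where
  open Spider S

  -- The index `2 + m` gives the centre two knees as neighbours; a knee always has two neighbours,
  -- its foot and the centre.
  spider-leaf : ∀ s {y} → Leaf G (place s) y → (∃[ j ] s ≡ pendant j) ⊎ (∃[ i ] s ≡ foot i)
  spider-leaf (pendant j) _ = inj₁ (j , refl)
  spider-leaf (foot i) _ = inj₂ (i , refl)
  spider-leaf centre (_ , only)
    with injective (trans (only _ (edge (fwd (thigh zero)))) (sym (only _ (edge (fwd (thigh (suc zero)))))))
  ... | ()
  spider-leaf (knee i) (_ , only)
    with injective (trans (only _ (edge (fwd (shin i)))) (sym (only _ (edge (bwd (thigh i))))))
  ... | ()

  leaf-place : ∀ {x y} → Leaf G x y →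
               (∃[ j ] x ≡ place (pendant j) × y ≡ place centre) ⊎
               (∃[ i ] x ≡ place (foot i) × y ≡ place (knee i))
  leaf-place {x} {y} leaf with surjective x
  ... | s , refl with spider-leaf s leaf
  ...   | inj₁ (j , refl) = inj₁ (j , refl , proj₂ (pendant-leaf j) y (proj₁ leaf))
  ...   | inj₂ (i , refl) = inj₂ (i , refl , proj₂ (foot-leaf i) y (proj₁ leaf))

  spider-no-twin-leaves : (∀ (j j′ : Fin e) → j ≡ j′) → NoTwinLeaves G
  spider-no-twin-leaves unique leaf-a leaf-b with leaf-place leaf-a | leaf-place leaf-b
  ... | inj₁ (j , refl , _) | inj₁ (j′ , refl , _) = cong (place ∘ pendant) (unique j j′)
  ... | inj₁ (_ , _ , eq) | inj₂ (_ , _ , eq′) with injective (trans (sym eq) eq′)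
  ...   | ()
  spider-no-twin-leaves unique leaf-a leaf-b | inj₂ (_ , _ , eq) | inj₁ (_ , _ , eq′)
    with injective (trans (sym eq) eq′)
  ...   | ()
  spider-no-twin-leaves unique leaf-a leaf-b | inj₂ (i , refl , eq) | inj₂ (i′ , refl , eq′)
    with injective (trans (sym eq) eq′)
  ...   | refl = refl

  spider-prime : 4 ≤ n → IsTree G → (∀ (j j′ : Fin e) → j ≡ j′) → Prime G
  spider-prime 4≤n tree unique = 4≤n , tree-module-trivial tree (spider-no-twin-leaves unique)

-- Without its foot a knee becomes a leaf at the centre beside the pendant, so every foot is pinned.
-- The pendant is not, because the centre keeps at least two knees.
spider⇒minus-1-critical : {G : Graph n} → 4 ≤ n → IsTree G → Spider 1 (2 + m) G → MinusCritical 1 G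
spider⇒minus-1-critical {n = suc n} {G = G} 4≤n tree S =
  spider-prime S 4≤n tree unique , ⁅ ℓ ⁆ , noncritical , ∣⁅x⁆∣≡1 ℓ
  where
  open Spider S
  ℓ = place (pendant zero)
  unique : (j j′ : Fin 1) → j ≡ j′
  unique zero zero = refl
  not-pinned : ¬ Pinned G ℓ (place centre)
  not-pinned p = knees-differ (trans (is-hub zero) (sym (is-hub (suc zero))))
    where
    open Pinned p
    knees-differ : place (knee zero) ≢ place (knee (suc zero))
    knees-differ eq with injective eq
    ... | ()
    is-hub : ∀ i → place (knee i) ≡ hub
    is-hub i with only (place (knee i)) (edge (fwd (thigh i)))
    ... | inj₂ eq = eq
    ... | inj₁ eq with injective eq
    ...   | ()
  foot-pinned : ∀ i → Pinned G (place (foot i)) (place (knee i))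
  foot-pinned i =
    pinned (edge (bwd (thigh i))) centre≢foot (knee-neighbour i) (pendant-leaf zero) pendant≢knee
    where
    centre≢foot : place centre ≢ place (foot i)
    centre≢foot eq with injective eq
    ... | ()
    pendant≢knee : ℓ ≢ place (knee i)
    pendant≢knee eq with injective eq
    ... | ()
  noncritical⇒ℓ : ∀ x → NonCritical G x → x ∈ ⁅ ℓ ⁆
  noncritical⇒ℓ x nc with noncritical⇒leaf {G = G} 4≤n tree nc
  ... | y , leaf with leaf-place S leaf
  ...   | inj₁ (zero , refl , _) = x∈⁅x⁆ _
  ...   | inj₂ (i , refl , refl) = contradiction (pinned⇒critical {G = G} leaf (foot-pinned i)) nc
  noncritical : ∀ x → x ∈ ⁅ ℓ ⁆ ⇔ NonCritical G x
  noncritical x = mk⇔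
    (λ x∈ → subst (NonCritical G) (sym (x∈⁅y⁆⇒x≡y ℓ x∈))
       (unpinned⇒noncritical tree (spider-no-twin-leaves S unique) (pendant-leaf zero) not-pinned))
    (noncritical⇒ℓ x)

-- With no pendant the centre supports no leaf, so no foot is pinned, and the feet are the only
-- leaves.
spider⇒minus-m-critical : {G : Graph n} → 4 ≤ n → IsTree G → Spider 0 (2 + m) G → MinusCritical (2 + m) G
spider⇒minus-m-critical {n = suc n} {m = m} {G = G} 4≤n tree S =
  spider-prime S 4≤n tree (λ ()) , feet , noncritical , image-size feet (place ∘ foot) foot-injective
    (λ x → mk⇔ (∈-comprehension⁻ Foot?) (∈-comprehension⁺ Foot?))
  where
  open Spider S
  Foot? : U.Decidable (λ x → ∃[ i ] place (foot i) ≡ x)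
  Foot? x = any? λ i → place (foot i) ≟ x
  feet = comprehension Foot?
  foot-injective : Injective _≡_ _≡_ (place ∘ foot)
  foot-injective eq with injective eq
  ... | refl = refl
  centre-supports-no-leaf : ∀ {x} → ¬ Leaf G x (place centre)
  centre-supports-no-leaf leaf with leaf-place S leaf
  ... | inj₂ (_ , _ , eq) with injective eq
  ...   | ()
  not-pinned : ∀ i → ¬ Pinned G (place (foot i)) (place (knee i))
  not-pinned i p with Pinned.only p _ (edge (bwd (thigh i)))
  ... | inj₂ refl = centre-supports-no-leaf (Pinned.leaf-twin p)
  ... | inj₁ eq with injective eq
  ...   | ()
  noncritical⇒foot : ∀ x → NonCritical G x → ∃[ i ] place (foot i) ≡ x
  noncritical⇒foot x nc with noncritical⇒leaf {G = G} 4≤n tree nc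
  ... | y , leaf with leaf-place S leaf
  ...   | inj₂ (i , eq , _) = i , sym eq
  foot-noncritical : ∀ i → NonCritical G (place (foot i))
  foot-noncritical i = unpinned⇒noncritical tree (spider-no-twin-leaves S (λ ())) (foot-leaf i) (not-pinned i)
  noncritical : ∀ x → x ∈ feet ⇔ NonCritical G x
  noncritical x = mk⇔
    (λ x∈ → let i , eq = ∈-comprehension⁻ Foot? x∈ in subst (NonCritical G) eq (foot-noncritical i))
    (∈-comprehension⁺ Foot? ∘ noncritical⇒foot x)

-- From non-critical vertices to spiders

-- Every unpinned leaf is `ℓ` and so has support `c`. A path of four vertices from `c` would lead to
-- an unpinned leaf supported elsewhere.
minus-1-critical⇒spider : {G : Graph n} → IsTree G → MinusCritical 1 G → ∃[ m ] Spider 1 (2 + m) G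
minus-1-critical⇒spider {n = suc n} {G = G} tree@(connected , acyclic) (prime@(4≤n , _) , S , S⇔nc , ∣S∣≡1)
  with singleton S ∣S∣≡1
... | ℓ , ℓ∈S , S-only with noncritical⇒leaf {G = G} 4≤n tree (Equivalence.to (S⇔nc ℓ) ℓ∈S)
...   | c , leaf-ℓ = two-legs (shallow-spider connected acyclic no-twins c shallow
          (λ (_ : Fin 1) → ℓ) (λ { {zero} {zero} _ → refl }) (λ _ → leaf-ℓ)
          (λ leaf → zero , no-twins leaf-ℓ leaf))
  where
  no-twins : NoTwinLeaves G
  no-twins = prime⇒no-twin-leaves {G = G} prime
  ℓ-only : ∀ {x y} → Leaf G x y → ¬ Pinned G x y → x ≡ ℓ × y ≡ c
  ℓ-only {x} {y} leaf ¬pinned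
    with S-only x (Equivalence.from (S⇔nc x) (unpinned⇒noncritical tree no-twins leaf ¬pinned))
  ... | refl = refl , proj₂ leaf-ℓ y (proj₁ leaf)
  shallow : ∀ {x y z w xs} → ¬ Path G c (x ∷ y ∷ z ∷ w ∷ xs)
  shallow p with deep-end acyclic no-twins p
  ... | record { rest = [] ; deep = () }
  ... | record { tip = z ; joint = w ; hip = v ; rest = u ∷ _
               ; path = extend (extend q@(extend q′ u~v v∉) v~w w∉) w~z z∉ ; leaf = leaf ; only = only }
      with any? (λ b → leaf? G b v)
  -- Only a leaf at `v` could pin `z`. Hence `z` is `ℓ` and its support `w` is the root, which
  -- already occurs further down the path.
  ...   | no ∄b = w∉ (subst (_∈ₗ _)
          (sym (proj₂ (ℓ-only leaf λ p → ∄b (Pinned.twin p , leaf-at-v p)))) (root∈ q))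
    where
    leaf-at-v : (p : Pinned G z w) → Leaf G (Pinned.twin p) v
    leaf-at-v p with only _ (Pinned.y~hub p)
    ... | inj₁ eq   = contradiction eq (Pinned.hub≢x p)
    ... | inj₂ refl = Pinned.leaf-twin p
  -- Besides `b`, the hip `v` has the neighbours `w` and `u`, so `b` is unpinned. Hence `b` is `ℓ`
  -- and `v` is the root, which already occurs further down the path.
  ...   | yes (b , leaf-b) = v∉ (subst (_∈ₗ _) (sym (proj₂ b≡ℓ)) (root∈ q′))
    where
    w≢b : w ≢ b
    w≢b refl = z∉ (there (here (proj₂ leaf-b z w~z)))
    -- If `u` were the leaf `b` at `v`, it would have no predecessor and be the root `c`. Then `v`
    -- would be `ℓ`, with `c` as its only neighbour, against the edge from `v` to `w`.
    u≢b : ∀ {us} → Path G c (u ∷ us) → v ∉ₗ u ∷ us → u ≢ b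
    u≢b start _ refl = w∉ (there (here (proj₂ leaf-ℓ w (subst (λ x → Adj G x w) (sym ℓ≡v) v~w))))
      where
      ℓ≡v : ℓ ≡ v
      ℓ≡v = proj₂ leaf-b ℓ (adj-sym G (proj₁ leaf-ℓ))
    u≢b (extend _ x~u _) v∉ refl = v∉ (there (here (sym (proj₂ leaf-b _ (adj-sym G x~u)))))
    b≡ℓ : b ≡ ℓ × v ≡ c
    b≡ℓ = ℓ-only leaf-b λ p → w∉ (there (here
      (trans (is-hub p v~w w≢b) (sym (is-hub p (adj-sym G u~v) (u≢b q′ v∉))))))
      where
      is-hub : (p : Pinned G b v) → ∀ {x} → Adj G v x → x ≢ b → x ≡ Pinned.hub p
      is-hub p {x} v~x x≢b with Pinned.only p x v~x
      ... | inj₁ eq = contradiction eq x≢b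
      ... | inj₂ eq = eq
  -- With no long leg there are only two vertices; with one, the tree is a path on four vertices,
  -- where the foot pins `ℓ`.
  two-legs : ∃[ m ] Σ (Spider 1 m G) (λ T → ∀ j → Spider.place T (pendant j) ≡ ℓ) →
             ∃[ m ] Spider 1 (2 + m) G
  two-legs (suc (suc m) , T , _) = m , T
  two-legs (zero , T , _)
    with third-element (≤-trans (ℕ.n≤1+n 3) 4≤n) (place centre) (place (pendant zero))
    where open Spider T
  ... | d , d≢c , d≢p with Spider.surjective T d
  ...   | centre , refl       = contradiction refl d≢c
  ...   | pendant zero , refl = contradiction refl d≢p
  two-legs (suc zero , T , at-ℓ) = contradiction
    (pinned⇒critical {G = G} (pendant-leaf zero)
      (pinned (edge (fwd (thigh zero))) knee≢pendant only (foot-leaf zero) foot≢centre))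
    (subst (NonCritical G) (sym (at-ℓ zero)) (Equivalence.to (S⇔nc ℓ) ℓ∈S))
    where
    open Spider T
    knee≢pendant : place (knee zero) ≢ place (pendant zero)
    knee≢pendant eq with injective eq
    ... | ()
    foot≢centre : place (foot zero) ≢ place centre
    foot≢centre eq with injective eq
    ... | ()
    only : ∀ x → Adj G (place centre) x → x ≡ place (pendant zero) ⊎ x ≡ place (knee zero)
    only x c~x with neighbour centre c~x
    ... | _ , eq , fwd (short zero) = inj₁ eq
    ... | _ , eq , fwd (thigh zero) = inj₂ eq

-- Two adjacent leaves form a whole component, leaving a third vertex unreachable.
adjacent-leaves : {G : Graph n} → 3 ≤ n → Connected G → Leaf G x y → ¬ Leaf G y z
adjacent-leaves {x = x} {y} {z} {G} 3≤n connected (x~y , x-only) (_ , y-only)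
  with third-element 3≤n x y
... | d , d≢x , d≢y = [ d≢x , d≢y ] (stays (connected x d) (inj₁ refl))
  where
  stays : ∀ {u v} → Star (Adj G) u v → u ≡ x ⊎ u ≡ y → v ≡ x ⊎ v ≡ y
  stays ε               at          = at
  stays (x~u ◅ u⇝v) (inj₁ refl) = stays u⇝v (inj₂ (x-only _ x~u))
  stays (y~u ◅ u⇝v) (inj₂ refl) = stays u⇝v (inj₁ (trans (y-only _ y~u) (sym (y-only _ (adj-sym G x~y)))))

-- `P-spider` already numbers the vertices of this model by `Fin (2 * m + 4)`.
spider-vertices-bound : (f : SpiderVertex 1 (suc m) → Fin n) → Injective _≡_ _≡_ f → 2 * m + 4 ≤ n
spider-vertices-bound {m = m} f f-injective = injective⇒≤ {f = f ∘ index} λ {x} {y} eq →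
  trans (sym (place-index x)) (trans (cong place (f-injective eq)) (place-index y))
  where open Spider (P-spider m)

half-double : ∀ k → ⌊ 2 * k /2⌋ ≡ k
half-double k = trans (cong (λ j → ⌊ k + j /2⌋) (ℕ.+-identityʳ k)) (sym (ℕ.n≡⌊n+n/2⌋ k))

half-odd : ∀ k → ⌊ 2 * k + 1 /2⌋ ≡ k
half-odd zero    = refl
half-odd (suc k) = trans (cong (λ j → ⌊ j + 1 /2⌋) (ℕ.*-suc 2 k)) (cong suc (half-odd k))

module _ {G : Graph (suc n)} (tree : IsTree G) (prime : Prime G) (S : Subset (suc n))
         (S⇔nc : ∀ x → x ∈ S ⇔ NonCritical G x) (∣S∣≡ : ∣ S ∣ ≡ ⌊ suc n /2⌋) where

  private
    connected = proj₁ tree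
    acyclic = proj₂ tree

    3≤1+n : 3 ≤ suc n
    3≤1+n = ≤-trans (ℕ.n≤1+n 3) (proj₁ prime)

    no-twins : NoTwinLeaves G
    no-twins = prime⇒no-twin-leaves {G = G} prime

    supported : x ∈ S → ∃[ y ] Leaf G x y
    supported {x} x∈S = noncritical⇒leaf {G = G} (proj₁ prime) tree (Equivalence.to (S⇔nc x) x∈S)

    Covered : Fin (suc n) → Set
    Covered y = y ∈ S ⊎ (∃[ x ] x ∈ S × Leaf G x y)

    Covered? : U.Decidable Covered
    Covered? y = (y ∈? S) ⊎-dec any? (λ x → x ∈? S ×-dec leaf? G x y)

    module _ (r y : Fin (suc n)) (r≢y : r ≢ y) (¬cov-r : ¬ Covered r) (¬cov-y : ¬ Covered y) where

      open Enumeration (enumerate S)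

      support-of : ∀ i → ∃[ z ] Leaf G (elem i) z
      support-of i = supported (member i)

      -- Two uncovered vertices, the members of `S` and their supports are laid out on the vertices
      -- of a model spider only in order to count them; its edges are ignored.
      spread : SpiderVertex 1 ∣ S ∣ → Fin (suc n)
      spread centre      = r
      spread (pendant _) = y
      spread (knee i)    = proj₁ (support-of i)
      spread (foot i)    = elem i

      ≢knee : ∀ {x} → ¬ Covered x → ∀ i → x ≢ spread (knee i)
      ≢knee ¬cov i refl = ¬cov (inj₂ (elem i , member i , proj₂ (support-of i)))

      ≢foot : ∀ {x} → ¬ Covered x → ∀ i → x ≢ spread (foot i)
      ≢foot ¬cov i refl = ¬cov (inj₁ (member i))

      knee≢foot : ∀ i j → spread (knee i) ≢ spread (foot j)
      knee≢foot i j eq = adjacent-leaves {G = G} 3≤1+n connected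
        (subst (Leaf G (elem i)) eq (proj₂ (support-of i))) (proj₂ (support-of j))

      spread-injective : Injective _≡_ _≡_ spread
      spread-injective {centre}       {centre}       eq = refl
      spread-injective {centre}       {pendant _}    eq = contradiction eq r≢y
      spread-injective {centre}       {knee i}       eq = contradiction eq (≢knee ¬cov-r i)
      spread-injective {centre}       {foot i}       eq = contradiction eq (≢foot ¬cov-r i)
      spread-injective {pendant _}    {centre}       eq = contradiction (sym eq) r≢y
      spread-injective {pendant zero} {pendant zero} eq = refl
      spread-injective {pendant _}    {knee i}       eq = contradiction eq (≢knee ¬cov-y i)
      spread-injective {pendant _}    {foot i}       eq = contradiction eq (≢foot ¬cov-y i)
      spread-injective {knee i}       {centre}       eq = contradiction (sym eq) (≢knee ¬cov-r i)
      spread-injective {knee i}       {pendant _}    eq = contradiction (sym eq) (≢knee ¬cov-y i)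
      spread-injective {knee i}       {knee j}       eq = cong knee (injective (no-twins
        (subst (Leaf G (elem i)) eq (proj₂ (support-of i))) (proj₂ (support-of j))))
      spread-injective {knee i}       {foot j}       eq = contradiction eq (knee≢foot i j)
      spread-injective {foot i}       {centre}       eq = contradiction (sym eq) (≢foot ¬cov-r i)
      spread-injective {foot i}       {pendant _}    eq = contradiction (sym eq) (≢foot ¬cov-y i)
      spread-injective {foot i}       {knee j}       eq = contradiction (sym eq) (knee≢foot j i)
      spread-injective {foot i}       {foot j}       eq = cong foot (injective eq)

      -- The model has `2 * k + 2` vertices, too many when `k` is half of `suc n` rounded down. The
      -- size is abstracted as `k` so that it can be split by cases.
      too-many : ∀ {k} → k ≡ ⌊ suc n /2⌋ → (f : SpiderVertex 1 k → Fin (suc n)) → ¬ Injective _≡_ _≡_ f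
      too-many {zero} eq _ _ = contradiction (subst (2 ≤_) (sym eq) (ℕ.⌊n/2⌋-mono (proj₁ prime))) λ ()
      too-many {suc t} eq f f-injective = n≮n (suc t) (subst₂ _≤_ half (sym eq)
        (ℕ.⌊n/2⌋-mono (spider-vertices-bound f f-injective)))
        where
        half : ⌊ 2 * t + 4 /2⌋ ≡ suc (suc t)
        half = trans (cong ⌊_/2⌋ (+-comm (2 * t) 4)) (cong (2 +_) (half-double t))

      uncovered-unique : ⊥
      uncovered-unique = too-many ∣S∣≡ spread spread-injective

    root : ∃[ r ] (∀ y → y ≢ r → Covered y)
    root with any? (λ y → ¬? (Covered? y))
    -- If every vertex is covered, any root serves; `root-uncovered` shows afterwards that this
    -- cannot happen.
    ... | no all-covered = zero , λ y _ → decidable-stable (Covered? y) λ ¬cov → all-covered (y , ¬cov)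
    ... | yes (r , ¬cov-r) = r , λ y y≢r → decidable-stable (Covered? y) λ ¬cov-y →
            uncovered-unique r y (≢-sym y≢r) ¬cov-r ¬cov-y

    module _ (ρ : Fin (suc n)) (covered : ∀ y → y ≢ ρ → Covered y) where

      -- The tip `z` is covered and, being a leaf, supports no leaf, so it lies in `S` and is not
      -- pinned. A leaf at the hip would pin `z`; a hip in `S` would be a leaf at `w`, a twin of
      -- `z`.
      hip-uncovered : ∀ {d} (D : DeepEnd G ρ d) → ¬ Covered (DeepEnd.hip D)
      hip-uncovered record { tip = z ; joint = w ; hip = v ; leaf = leaf ; only = only
                           ; path = extend q@(extend _ v~w w∉) w~z z∉ } =
        λ { (inj₁ v∈S) → z≢v (sym (no-twins (leaf-at-w (proj₂ (supported v∈S))) leaf))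
          ; (inj₂ (x , _ , leaf-x)) → hip-supports-no-leaf leaf-x }
        where
        z≢v : z ≢ v
        z≢v refl = z∉ (there (here refl))
        leaf-at-w : ∀ {y} → Leaf G v y → Leaf G v w
        leaf-at-w leaf-v = subst (Leaf G v) (sym (proj₂ leaf-v w v~w)) leaf-v
        z∈S : z ∈ S
        z∈S with covered z (λ { refl → z∉ (root∈ q) })
        ... | inj₁ z∈S = z∈S
        ... | inj₂ (_ , _ , leaf-x) = contradiction leaf (adjacent-leaves {G = G} 3≤1+n connected leaf-x)
        hip-supports-no-leaf : ∀ {x} → ¬ Leaf G x v
        hip-supports-no-leaf {x} leaf-x = Equivalence.to (S⇔nc z) z∈S (pinned⇒critical {G = G} leaf
          (pinned (adj-sym G v~w) (≢-sym z≢v) only leaf-x λ { refl → z≢v (proj₂ leaf-x z w~z) }))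

      hip-is-root : ∀ {d} (D : DeepEnd G ρ d) → DeepEnd.hip D ≡ ρ
      hip-is-root D = decidable-stable (_ ≟ ρ) λ v≢ρ → hip-uncovered D (covered _ v≢ρ)

      -- The hip of a deep end is the root itself, so the path has nothing below it.
      shallow : ∀ {x y z w xs} → ¬ Path G ρ (x ∷ y ∷ z ∷ w ∷ xs)
      shallow p with deep-end acyclic no-twins p
      ... | record { rest = [] ; deep = () }
      ... | D@(record { rest = _ ∷ _ ; path = extend (extend (extend q _ v∉) _ _) _ _ }) =
        v∉ (subst (_∈ₗ _) (sym (hip-is-root D)) (root∈ q))

      LongPath : Set
      LongPath = ∃[ x ] ∃[ y ] ∃[ z ] ∃[ xs ] Path G ρ (x ∷ y ∷ z ∷ xs)

      long-path-or-leaf : ∀ d → d ≢ ρ → LongPath ⊎ Leaf G d ρ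
      long-path-or-leaf d d≢ρ with connected⇒path connected ρ d
      ... | [] , start = contradiction refl d≢ρ
      ... | _ ∷ _ ∷ _ , p = inj₁ (_ , _ , _ , _ , p)
      ... | _ ∷ [] , p@(extend start ρ~d _) with any? (λ w → adj? G d w ×-dec ¬? (w ≟ ρ))
      ...   | yes (w , d~w , w≢ρ) = inj₁ (_ , _ , _ , _ ,
                extend p d~w (w≢ρ ∘ neighbour-on-path acyclic p d~w))
      ...   | no ∄w = inj₂ (adj-sym G ρ~d , λ w d~w → decidable-stable (w ≟ ρ) λ w≢ρ → ∄w (w , d~w , w≢ρ))

      -- Supplies a deep end, whose hip shows that the root is uncovered. Of two vertices other than
      -- `ρ`, at most one is a leaf at `ρ`, and the other lies on or leads to a long path.
      long-path : LongPath
      long-path =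
        let d , d≢ρ , _ = third-element 3≤1+n ρ ρ
            d′ , d′≢ρ , d′≢d = third-element 3≤1+n ρ d
        in [ id , (λ leaf → [ id , (λ leaf′ → contradiction (no-twins leaf′ leaf) d′≢d) ]
                               (long-path-or-leaf d′ d′≢ρ)) ]
             (long-path-or-leaf d d≢ρ)

      root-uncovered : ¬ Covered ρ
      root-uncovered =
        let _ , _ , _ , _ , p = long-path
            D = deep-end acyclic no-twins p
        in subst (λ v → ¬ Covered v) (hip-is-root D) (hip-uncovered D)

      -- A leaf at the root is covered: in `S` it would cover the root, and as a support it would be
      -- adjacent to another leaf. Hence the spider has no short leg.
      no-pendant : ¬ Leaf G x ρ
      no-pendant {x} leaf with covered x (adjacent⇒≢ G (proj₁ leaf))
      ... | inj₁ x∈S = root-uncovered (inj₂ (x , x∈S , leaf))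
      ... | inj₂ (_ , _ , leaf-y) = adjacent-leaves {G = G} 3≤1+n connected leaf-y leaf

      rooted-spider : ∃[ m ] Spider 0 m G
      rooted-spider =
        let m , T , _ = shallow-spider connected acyclic no-twins ρ shallow (λ ()) (λ { {()} }) (λ ())
                          (λ leaf → contradiction leaf no-pendant)
        in m , T

  half-noncritical⇒spider : ∃[ m ] Spider 0 m G
  half-noncritical⇒spider = let ρ , covered = root in rooted-spider ρ covered

-- The two characterisations.

isomorphic⇒same-size : {G : Graph k} {H : Graph n} → G ≃ H → k ≡ n
isomorphic⇒same-size = ↔⇒≡ ∘ _≃_.bijection

minus-1-critical⇒P : {T : Graph n} → IsTree T → MinusCritical 1 T →
                     2 ∣ n × 6 ≤ n × T ≃ P 4 ⌊ n ∸ 4 /2⌋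
minus-1-critical⇒P {T = T} tree critical with minus-1-critical⇒spider tree critical
... | m , S with spiders-isomorphic S (P-spider (suc m))
...   | T≃P with isomorphic⇒same-size T≃P
...     | refl = ∣m∣n⇒∣m+n (m∣m*n {2} (suc m)) (divides 2 refl) ,
                 ℕ.+-monoˡ-≤ 4 (ℕ.*-monoʳ-≤ 2 (s≤s (z≤n {m}))) ,
                 subst (λ t → T ≃ P 4 t)
                   (sym (trans (cong ⌊_/2⌋ (ℕ.m+n∸n≡m (2 * suc m) 4)) (half-double (suc m)))) T≃P

-- The parameter `t` is left general so that it can be split: `t = 0` gives four vertices, against
-- `6 ≤ n`, and otherwise there are at least two long legs.
P⇒minus-1-critical : {T : Graph n} → ∀ t → IsTree T → 6 ≤ n → T ≃ P 4 t → MinusCritical 1 T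
P⇒minus-1-critical zero _ 6≤n T≃P =
  contradiction (subst (6 ≤_) (isomorphic⇒same-size T≃P) 6≤n) λ { (s≤s (s≤s (s≤s (s≤s ())))) }
P⇒minus-1-critical (suc t) tree 6≤n T≃P = spider⇒minus-1-critical (≤-trans (ℕ.m≤m+n 4 2) 6≤n) tree
  (spider-transport T≃P (P-spider (suc t)))

-- The number `m` of legs is read off the spider. The resulting size `2 * m + 1` yields the parity
-- and identifies `m` with `⌊ n /2⌋`.
minus-half-critical⇒A : {T : Graph n} → IsTree T → MinusCritical ⌊ n /2⌋ T →
                        2 ∤ n × 5 ≤ n × T ≃ A[2* ⌊ n /2⌋ +1]
minus-half-critical⇒A {n = suc n} {T} tree (prime , S , S⇔nc , ∣S∣≡)
  with half-noncritical⇒spider tree prime S S⇔nc ∣S∣≡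
... | m , spider with spiders-isomorphic spider (A-spider m)
...   | T≃A = subst (2 ∤_) (sym size) odd , 5≤ m size (proj₁ prime) ,
              subst (λ k → T ≃ A[2* k +1]) (sym (trans (cong ⌊_/2⌋ size) (half-odd m))) T≃A
  where
  size : suc n ≡ 2 * m + 1
  size = isomorphic⇒same-size T≃A
  odd : 2 ∤ 2 * m + 1
  odd 2∣ with ∣1⇒≡1 (∣m+n∣m⇒∣n 2∣ (m∣m*n {2} m))
  ... | ()
  5≤ : ∀ {n} m → n ≡ 2 * m + 1 → 4 ≤ n → 5 ≤ n
  5≤ 0 refl (s≤s ())
  5≤ 1 refl (s≤s (s≤s (s≤s ())))
  5≤ (suc (suc m)) refl _ = ℕ.+-monoˡ-≤ 1 (ℕ.*-monoʳ-≤ 2 (s≤s (s≤s (z≤n {m}))))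

A⇒minus-half-critical : {T : Graph n} → ∀ m → IsTree T → 5 ≤ n → T ≃ A[2* m +1] → MinusCritical m T
A⇒minus-half-critical 0 _ 5≤n T≃A =
  contradiction (subst (5 ≤_) (isomorphic⇒same-size T≃A) 5≤n) λ { (s≤s ()) }
A⇒minus-half-critical 1 _ 5≤n T≃A =
  contradiction (subst (5 ≤_) (isomorphic⇒same-size T≃A) 5≤n) λ { (s≤s (s≤s (s≤s ()))) }
A⇒minus-half-critical (suc (suc m)) tree 5≤n T≃A = spider⇒minus-m-critical (≤-trans (ℕ.m≤m+n 4 1) 5≤n) tree
  (spider-transport T≃A (A-spider (2 + m)))

proposition2p5 : (∀ (n : ℕ) (T : Graph n) → IsTree T →
    (MinusCritical 1 T ⇔ (2 ∣ n × 6 ≤ n × T ≃ P 4 ⌊ n ∸ 4 /2⌋)))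
    ×
    (∀ (n : ℕ) (T : Graph n) → IsTree T →
    (MinusCritical ⌊ n /2⌋ T ⇔ (2 ∤ n × 5 ≤ n × T ≃ A[2* ⌊ n /2⌋ +1])))
proposition2p5 =
  (λ n T tree → mk⇔ (minus-1-critical⇒P tree)
     (λ { (_ , 6≤n , T≃P) → P⇒minus-1-critical _ tree 6≤n T≃P })) ,
  (λ n T tree → mk⇔ (minus-half-critical⇒A tree)
     (λ { (_ , 5≤n , T≃A) → A⇒minus-half-critical _ tree 5≤n T≃A }))
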